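{- Given a real-valued function $w(\cdot,\cdot)$ that can be computed in $O(1)$ time with no memory access, and an initial value $D[0]$, consider the 1D recurrences $$D[j]=\min_{0\le i<j}\{D[i]+w(i,j)\}\qquad\text{for }1\le j\le n.$$ There is a Nested Dataflow (ND) algorithm that solves these recurrences (i.e. computes $D[1],\dots,D[n]$) in $O(n)$ time, optimal $O(n^2)$ work, $O(n)$ space, and $O(n^2/(BM))$ cache bounds.
   Context: **Work-time (work-span) model.** A parallel computation is viewed as a directed acyclic graph (DAG). Each vertex is a piece of computation with no parallel construct, and each directed edge is a control or data dependency between two vertices. Every arithmetic operation (multiplication, addition, comparison) counts as $O(1)$. The time $T_\infty$ is the number of arithmetic operations along the critical path of the DAG. The work $T_1$ is the sum over all vertices. Space is the amount of memory used. Memory is CREW (concurrent read, exclusive write): concurrent reads of the same location take $O(1)$ time, while $k$ concurrent writes to the same cell must be serialized and take $O(k)$ total time. **Cache model.** The cache bound is the serial cache complexity $Q_1$ in the ideal cache model: the number of cache misses when all parallel constructs are serialized in some order and run on one core, with an upper-level cache of size $M$, an unbounded lower-level memory, data exchanged in cache lines of size $B$ under an omniscient (offline optimal) replacement policy, and a tall cache, $M=\Omega(B^2)$. **ND model.** A task is a set of vertices of the DAG. For tasks $a,b$ there are three composition constructs: $a\parallel b$ (no subtask of $b$ depends on any subtask of $a$); $a\,;\,b$ (all subtasks of $b$ depend on all subtasks of $a$); and the "fire" construct $a\leadsto b$ (partial dependency: a subset of the subtasks of $b$ depends on a subset of the subtasks of $a$). A fire construct is refined recursively, by specified fire rules, into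 dependencies between subtasks, until both its source and sink are leaf vertices (vertices with no parallel construct), where it becomes $a\,;\,b$. A subtask may start as soon as its data dependencies are satisfied. An ND algorithm is an algorithm expressed with these constructs. **Optimality.** "Optimal" work means that the total work asymptotically matches that of the best serial algorithm for the same problem.
   Formalization: The O(n²/(BM)) cache bound is stated for M ≤ n only (the problem does not fit in the cache): for fixed n and M growing, n²/(BM) tends to 0, while writing the n outputs from an empty cache always costs about n/B misses. -}

module Defs where

open import Algebra.Bundles using (CommutativeRing)
open import Data.Bool.Base using (if_then_else_)
open import Data.Fin.Base using (Fin)
open import Data.List.Base using (List; []; _∷_; _++_; map; concatMap; length; sum; foldl)
open import Data.List.Membership.Propositional using (_∈_)
open import Data.List.Relation.Binary.Permutation.Propositional using (_↭_)
open import Data.List.Relation.Binary.Subset.Propositional using (_⊆_)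
open import Data.List.Relation.Unary.All using (All)
open import Data.List.Relation.Unary.AllPairs using (AllPairs)
open import Data.List.Relation.Unary.Linked using (Linked)
open import Data.Maybe.Base using (Maybe; just; nothing)
open import Data.Nat.Base using (ℕ; suc; _+_; _*_; _≤_; _<_; NonZero)
open import Data.Nat.DivMod using (_/_)
open import Data.Nat.Properties using (_≟_)
open import Data.Product.Base using (_×_; _,_; ∃-syntax; proj₁; proj₂)
open import Data.Sum.Base using (_⊎_)
open import Function.Base using (_∘_)
open import Level using (Level; _⊔_) renaming (suc to lsuc)
open import Relation.Binary.Construct.Closure.Transitive using (TransClosure)
open import Relation.Binary.Core using (Rel)
open import Relation.Binary.PropositionalEquality.Core using (_≡_; _≢_)
open import Relation.Binary.Structures using (IsDecTotalOrder)
open import Relation.Nullary.Decidable.Core using (does)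
open import Relation.Nullary.Negation.Core using (¬_)
open import Relation.Unary using (Pred)

------------------------------------------------------------------------
-- The real numbers

-- A Dedekind-complete ordered field, hence classically ℝ up to a unique
-- isomorphism.  The order is decidable because the cost model treats
-- the exact comparison of two reals as a single operation.

record RealField (c ℓ₁ ℓ₂ : Level) : Set (lsuc (c ⊔ ℓ₁ ⊔ ℓ₂)) where
  field
    commutativeRing : CommutativeRing c ℓ₁

  open CommutativeRing commutativeRing public
    using (Carrier; _≈_; 0#; 1#)
    renaming (_+_ to _+ᴿ_; _*_ to _*ᴿ_)

  field
    _≤ᴿ_            : Rel Carrier ℓ₂
    isDecTotalOrder : IsDecTotalOrder _≈_ _≤ᴿ_
    0≉1             : ¬ (0# ≈ 1#)
    inverse         : ∀ x → ¬ (x ≈ 0#) → ∃[ y ] (x *ᴿ y) ≈ 1#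
    +-monoˡ-≤       : ∀ {x y} z → x ≤ᴿ y → (x +ᴿ z) ≤ᴿ (y +ᴿ z)
    *-nonNeg        : ∀ {x y} → 0# ≤ᴿ x → 0# ≤ᴿ y → 0# ≤ᴿ (x *ᴿ y)

  UpperBound : Pred Carrier (c ⊔ ℓ₁ ⊔ ℓ₂) → Carrier → Set (c ⊔ ℓ₁ ⊔ ℓ₂)
  UpperBound P b = ∀ x → P x → x ≤ᴿ b

  field
    supremum : (P : Pred Carrier (c ⊔ ℓ₁ ⊔ ℓ₂)) →
               ∃[ x ] P x → ∃[ b ] UpperBound P b →
               ∃[ s ] (UpperBound P s × (∀ b → UpperBound P b → s ≤ᴿ b))

  open IsDecTotalOrder isDecTotalOrder public
    using () renaming (_≤?_ to _≤ᴿ?_)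

------------------------------------------------------------------------
-- Sequential code

Address : Set
Address = ℕ

-- There are no registers: every operand lives in memory, so that all
-- storage is charged for.  The first argument is always the destination.
-- `select d x y u v` stores u in d if x ≤ y, and v otherwise.
-- `weight d i j` evaluates w(i,j) and touches no memory except d.

data Instr : Set where
  move    : (d x : Address) → Instr
  add mul : (d x y : Address) → Instr
  select  : (d x y u v : Address) → Instr
  weight  : (d : Address) (i j : ℕ) → Instr

target : Instr → Address
target (move d _)         = d
target (add d _ _)        = d
target (mul d _ _)        = d
target (select d _ _ _ _) = d
target (weight d _ _)     = d

sources : Instr → List Address
sources (move _ x)         = x ∷ []
sources (add _ x y)        = x ∷ y ∷ []
sources (mul _ x y)        = x ∷ y ∷ []
sources (select _ x y u v) = x ∷ y ∷ u ∷ v ∷ []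
sources (weight _ _ _)     = []

Strand : Set
Strand = List Instr

reads writes trace : Strand → List Address
reads  = concatMap sources
writes = map target
trace  = concatMap (λ ι → sources ι ++ target ι ∷ [])

-- Serial algorithms may in addition branch on comparisons;
-- `branch x y p q` continues with p if x ≤ y, and with q otherwise.

data Serial : Set where
  halt   : Serial
  _▸_    : Instr → Serial → Serial
  branch : (x y : Address) → Serial → Serial → Serial

------------------------------------------------------------------------
-- Nested dataflow tasks

data Construct (F : Set) : Set where
  par seq : Construct F
  fire    : F → Construct F

data Task (F : Set) : Set where
  leaf : Strand → Task F
  node : Construct F → Task F → Task F → Task F

data Side : Set where
  L R : Side

Path : Set
Path = List Side

subtask : ∀ {F} → Task F → Path → Maybe (Task F)
subtask t            []      = just t
subtask (leaf _)     (_ ∷ _) = nothing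
subtask (node _ a _) (L ∷ p) = subtask a p
subtask (node _ _ b) (R ∷ p) = subtask b p

-- (p , κ , q) makes the construct κ hold between the subtask at p of the
-- source and the subtask at q of the sink.

FireRule : Set → Set
FireRule F = Path × Construct F × Path

Vertex : Set
Vertex = Path × Strand

cost : Vertex → ℕ
cost = length ∘ proj₂

under : Side → Vertex → Vertex
under s (p , c) = s ∷ p , c

-- Listed in the order of the serialization in which the left operand of
-- every construct runs first.  This order respects all dependencies.

vertices : ∀ {F} → Task F → List Vertex
vertices (leaf c)     = ([] , c) ∷ []
vertices (node _ a b) = map (under L) (vertices a) ++ map (under R) (vertices b)

module DAG {F : Set} (rules : F → List (FireRule F)) where

  -- Depends κ a b x y: when a and b are composed by κ, leaf y of b
  -- depends directly on leaf x of a.  A fire rule is inapplicable if one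
  -- of its paths leaves the tree; it then contributes no dependency.

  data Depends : Construct F → Task F → Task F → Path → Path → Set where
    all-leaves : ∀ {a b x y c d} →
                 subtask a x ≡ just (leaf c) → subtask b y ≡ just (leaf d) →
                 Depends seq a b x y
    two-leaves : ∀ {f c d} → Depends (fire f) (leaf c) (leaf d) [] []
    refine     : ∀ {f a b a′ b′ p κ q x y} →
                 (p , κ , q) ∈ rules f →
                 subtask a p ≡ just a′ → subtask b q ≡ just b′ →
                 Depends κ a′ b′ x y →
                 Depends (fire f) a b (p ++ x) (q ++ y)

  data Edge : Task F → Path → Path → Set where
    inˡ    : ∀ {κ a b x y} → Edge a x y → Edge (node κ a b) (L ∷ x) (L ∷ y)
    inʳ    : ∀ {κ a b x y} → Edge b x y → Edge (node κ a b) (R ∷ x) (R ∷ y)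
    across : ∀ {κ a b x y} → Depends κ a b x y → Edge (node κ a b) (L ∷ x) (R ∷ y)

  _⊢_⟶_ : Task F → Vertex → Vertex → Set
  t ⊢ u ⟶ v = Edge t (proj₁ u) (proj₁ v)

  Precedes : Task F → Vertex → Vertex → Set
  Precedes t u v = TransClosure (Edge t) (proj₁ u) (proj₁ v)

  record IsSchedule (t : Task F) (σ : List Vertex) : Set where
    field
      complete : σ ↭ vertices t
      ordered  : AllPairs (λ u v → ¬ (t ⊢ v ⟶ u)) σ

  -- Vertices that may run concurrently never access a common location
  -- unless both only read it.  So no write is ever delayed by another
  -- one, and every interleaving of the vertices' instructions has the
  -- effect of some schedule.

  RaceFree : Task F → Set
  RaceFree t = ∀ {u v} → u ∈ vertices t → v ∈ vertices t → proj₁ u ≢ proj₁ v →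
               ∀ {a} → a ∈ writes (proj₂ u) → a ∈ reads (proj₂ v) ++ writes (proj₂ v) →
               Precedes t u v ⊎ Precedes t v u

  -- T∞ ≤ b, T∞ being the maximal cost of a directed path.

  SpanAtMost : Task F → ℕ → Set
  SpanAtMost t b = ∀ π → All (_∈ vertices t) π → Linked (t ⊢_⟶_) π →
                   sum (map cost π) ≤ b

work : ∀ {F} → Task F → ℕ
work t = sum (map cost (vertices t))

serialTrace : ∀ {F} → Task F → List Address
serialTrace t = concatMap (trace ∘ proj₂) (vertices t)

-- The memory is an array of s cells.

SpaceAtMost : ∀ {F} → Task F → ℕ → Set
SpaceAtMost t s = All (_< s) (serialTrace t)

------------------------------------------------------------------------
-- The ideal cache

-- Serves k C ls q: starting with the lines C in a fully associative
-- cache of k lines, some choice of evictions, made knowing all of ls,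
-- serves the requests ls with q misses.

data Serves (k : ℕ) : List ℕ → List ℕ → ℕ → Set where
  done : ∀ {C} → Serves k C [] 0
  hit  : ∀ {C l ls q} → l ∈ C → Serves k C ls q → Serves k C (l ∷ ls) q
  miss : ∀ {C C′ l ls q} → l ∈ C′ → C′ ⊆ l ∷ C → length C′ ≤ k →
         Serves k C′ ls q → Serves k C (l ∷ ls) (suc q)

-- Q₁ ≤ q, Q₁ being the least number of misses from an empty cache.

MissesAtMost : ∀ {F} → Task F → (M B : ℕ) → .{{NonZero B}} → ℕ → Set
MissesAtMost t M B q =
  ∃[ m ] (m ≤ q × Serves (M / B) [] (map (_/ B) (serialTrace t)) m)

------------------------------------------------------------------------
-- Algorithms

-- The finitely many fire rules are shared by all problem sizes, and the
-- tasks know neither w, D[0] nor the cache parameters.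

record NDAlgorithm : Set where
  field
    fireTypes : ℕ
    rules     : Fin fireTypes → List (FireRule (Fin fireTypes))
    task      : ℕ → Task (Fin fireTypes)

  open DAG rules public

module Execution {c ℓ₁ ℓ₂} (ℝ : RealField c ℓ₁ ℓ₂) where
  open RealField ℝ

  Memory : Set c
  Memory = Address → Carrier

  Weight : Set c
  Weight = ℕ → ℕ → Carrier

  _[_≔_] : Memory → Address → Carrier → Memory
  (μ [ d ≔ r ]) a = if does (a ≟ d) then r else μ a

  value : Weight → Instr → Memory → Carrier
  value w (move _ x)         μ = μ x
  value w (add _ x y)        μ = μ x +ᴿ μ y
  value w (mul _ x y)        μ = μ x *ᴿ μ y
  value w (select _ x y u v) μ = if does (μ x ≤ᴿ? μ y) then μ u else μ v
  value w (weight _ i j)     μ = w i j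

  step : Weight → Memory → Instr → Memory
  step w μ ι = μ [ target ι ≔ value w ι μ ]

  runSchedule : Weight → Memory → List Vertex → Memory
  runSchedule w = foldl (λ μ v → foldl (step w) μ (proj₂ v))

  runSerial : Weight → Memory → Serial → Memory
  runSerial w μ halt             = μ
  runSerial w μ (ι ▸ p)          = runSerial w (step w μ ι) p
  runSerial w μ (branch x y p q) =
    if does (μ x ≤ᴿ? μ y) then runSerial w μ p else runSerial w μ q

  serialWork : Weight → Memory → Serial → ℕ
  serialWork w μ halt             = 0
  serialWork w μ (ι ▸ p)          = suc (serialWork w (step w μ ι) p)
  serialWork w μ (branch x y p q) =
    suc (if does (μ x ≤ᴿ? μ y) then serialWork w μ p else serialWork w μ q)

  IsMinimumBelow : ℕ → (ℕ → Carrier) → Carrier → Set (ℓ₁ ⊔ ℓ₂)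
  IsMinimumBelow j f x =
    (∀ i → i < j → x ≤ᴿ f i) × ∃[ i ] (i < j × x ≈ f i)

  -- D[j] is kept at address j: the input D[0] is at address 0 of the
  -- initial memory μ, whose other cells have arbitrary contents, and
  -- D[0], …, D[n] are at the addresses 0, …, n of the final memory D.

  Solution : Weight → ℕ → (μ D : Memory) → Set (ℓ₁ ⊔ ℓ₂)
  Solution w n μ D =
    D 0 ≈ μ 0 ×
    (∀ j → 1 ≤ j → j ≤ n → IsMinimumBelow j (λ i → D i +ᴿ w i j) (D j))

  Solves : NDAlgorithm → Set (c ⊔ ℓ₁ ⊔ ℓ₂)
  Solves A = ∀ n → RaceFree (task n) ×
    (∀ w μ σ → IsSchedule (task n) σ → Solution w n μ (runSchedule w μ σ))
    where open NDAlgorithm A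

  SerialSolves : ℕ → Serial → Set (c ⊔ ℓ₁ ⊔ ℓ₂)
  SerialSolves n p = ∀ w μ → Solution w n μ (runSerial w μ p)

  -- Up to a constant factor, no serial algorithm has a smaller
  -- worst-case work.

  WorkOptimal : NDAlgorithm → Set (c ⊔ ℓ₁ ⊔ ℓ₂)
  WorkOptimal A = ∃[ k ] (∀ n → 1 ≤ n → ∀ p → SerialSolves n p →
    ∃[ w ] ∃[ μ ] work (task n) ≤ k * serialWork w μ p)
    where open NDAlgorithm A

------------------------------------------------------------------------
-- Asymptotic cost bounds

module Costs (A : NDAlgorithm) where
  open NDAlgorithm A

  LinearTime : Set
  LinearTime = ∃[ k ] (∀ n → 1 ≤ n → SpanAtMost (task n) (k * n))

  QuadraticWork : Set
  QuadraticWork = ∃[ k ] (∀ n → 1 ≤ n → work (task n) ≤ k * (n * n))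

  LinearSpace : Set
  LinearSpace = ∃[ k ] (∀ n → 1 ≤ n → SpaceAtMost (task n) (k * n))

  -- Q₁ = O(n² / (B M)) under the tall-cache assumption B² ≤ τ M, with a
  -- constant independent of n, M and B.  As n² / (B M) → 0 when M grows
  -- for a fixed n, whereas writing n outputs costs n / B misses, the
  -- bound is about problems that do not fit in the cache: M ≤ n.

  CacheBound : Set
  CacheBound = ∀ τ → ∃[ k ] (∀ n M B → .{{_ : NonZero B}} →
    B ≤ M → B * B ≤ τ * M → M ≤ n →
    ∃[ q ] (MissesAtMost (task n) M B q × q * (B * M) ≤ k * (n * n)))

{-# OPTIONS --safe #-}
-- Index the update of D[b] by D[a] + w(a,b) by the cell (a,b), a < b, and let
-- the diagonal cell (b,b) stand for "D[b] is final".  A triangle of cells is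
-- split into two triangles and a square, a square into four squares.  Only the
-- first triangle and the square are composed by a fire construct, which is
-- refined to the dependencies of row a on the diagonal cell (a,a).  Hence every
-- dependency either increases the row or leaves a diagonal cell along its row,
-- and a path meets at most two cells per row: the span is linear although the
-- other constructs of the recursion are serial or parallel.  Conversely, these
-- dependencies make every schedule execute each column from top to bottom, and
-- cell (a,b) after column a, which gives race freedom and correctness.
--
-- For the cache bound, stop the recursion at the blocks of side S = Θ(M) whose
-- lines fit into the cache: there are O((n / S)²) of them, with O(S / B) misses
-- each.  A serial program performs Ω(n²) instructions because on zero weights
-- it has to evaluate w(i,j) for all i < j ≤ n.
module Submission where

open import Defs
open import Algebra.Bundles using (CommutativeRing)
open import Data.Bool.Base using (if_then_else_; true; false)
open import Data.Fin.Base using (Fin; zero)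
open import Data.List.Base using (List; []; _∷_; _++_; map; length; upTo; concatMap; foldl)
import Data.List.Membership.DecPropositional as DecMembership
open import Data.List.Membership.Propositional using (_∈_; find)
open import Data.List.Membership.Propositional.Properties 
  using (∈-map⁺; ∈-map⁻; ∈-++⁺ˡ; ∈-++⁺ʳ; ∈-++⁻; ∈-upTo⁺; ∈-upTo⁻; ∈-∃++; ∈-concatMap⁻)
open import Data.List.Properties 
  using (length-++; length-map; length-upTo; map-++; map-∘; ++-assoc; ++-identityʳ; concatMap-++;
         concatMap-map; ∷-injectiveˡ)
open import Data.List.Relation.Binary.Permutation.Propositional using (↭-sym; ↭⇒↭ₛ)
open import Data.List.Relation.Binary.Permutation.Propositional.Properties using (∈-resp-↭)
import Data.List.Relation.Binary.Permutation.Setoid.Properties as Permutationₛ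
open import Data.List.Relation.Binary.Subset.Propositional using (_⊆_)
open import Data.List.Relation.Binary.Subset.Propositional.Properties using (∷⁺ʳ)
open import Data.List.Relation.Unary.All as All using (All; []; _∷_)
open import Data.List.Relation.Unary.AllPairs using ([]; _∷_; AllPairs)
open import Data.List.Relation.Unary.Any using (here; there)
open import Data.List.Relation.Unary.Linked using (Linked; []; [-]; _∷_)
open import Data.List.Relation.Unary.Unique.Propositional using (Unique)
import Data.List.Relation.Unary.Unique.Propositional.Properties as Unique
open import Data.Maybe.Base using (just)
open import Data.Nat.Base 
  using (ℕ; zero; suc; _+_; _*_; _∸_; _⊓_; _≤_; _<_; z≤n; s≤s; NonZero; >-nonZero⁻¹)
open import Data.Nat.DivMod using (_/_; /-monoˡ-≤; m<n*o⇒m/o<n; m*n/n≡m; m/n*n≤m; n/n≡1)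
open import Data.Nat.Induction using (<-rec)
open import Data.Nat.ListAction using (sum)
open import Data.Nat.ListAction.Properties using (sum-++)
open import Data.Nat.Properties
open import Data.Nat.Tactic.RingSolver using (solve-∀)
open import Data.Product.Base using (_×_; _,_; ∃-syntax; proj₁; proj₂)
open import Data.Product.Properties using (≡-dec)
open import Data.Sum.Base using (_⊎_; inj₁; inj₂)
open import Function.Base using (_∘_; case_of_)
open import Level using (Level; _⊔_)
open import Relation.Binary.Construct.Closure.Transitive using ([_]; _∷_)
open import Relation.Binary.Definitions using (tri<; tri≈; tri>; DecidableEquality)
open import Relation.Binary.PropositionalEquality 
  using (_≡_; _≢_; refl; sym; trans; cong; cong₂; subst; setoid; module ≡-Reasoning)
open import Relation.Binary.Structures using (IsDecTotalOrder)
open import Relation.Nullary using (¬_; yes; no; does; contradiction; Dec)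
open import Relation.Nullary.Decidable using (dec-true; dec-false)

private
  variable
    a b a′ b′ i j k o m n r K : ℕ
    p q : Path
    c : Strand
    C ls ls′ : List ℕ

-- Vertices of a task and leaves of its tree.

vertex⇒leaf : ∀ {F} (t : Task F) → (p , c) ∈ vertices t → subtask t p ≡ just (leaf c)
vertex⇒leaf (leaf _) (here refl) = refl
vertex⇒leaf (node _ s t) m with ∈-++⁻ (map (under L) (vertices s)) m
... | inj₁ n with _ , v , refl ← ∈-map⁻ (under L) n = vertex⇒leaf s v
... | inj₂ n with _ , v , refl ← ∈-map⁻ (under R) n = vertex⇒leaf t v

leaf⇒vertex : ∀ {F} (t : Task F) p → subtask t p ≡ just (leaf c) → (p , c) ∈ vertices t
leaf⇒vertex (leaf _)     []      refl = here refl
leaf⇒vertex (leaf _)     (_ ∷ _) ()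
leaf⇒vertex (node _ s t) []      ()
leaf⇒vertex (node _ s t) (L ∷ p) e =
  ∈-++⁺ˡ (∈-map⁺ (under L) (leaf⇒vertex s p e))
leaf⇒vertex (node _ s t) (R ∷ p) e =
  ∈-++⁺ʳ (map (under L) (vertices s)) (∈-map⁺ (under R) (leaf⇒vertex t p e))

under-injective : ∀ {s u v} → under s u ≡ under s v → u ≡ v
under-injective refl = refl

-- Paths tell vertices apart even when strands coincide. In a schedule this prevents an executed
-- vertex from coming up again.
vertices-unique : ∀ {F} (t : Task F) → Unique (vertices t)
vertices-unique (leaf _)     = [] ∷ []
vertices-unique (node _ s t) =
  Unique.++⁺ (Unique.map⁺ under-injective (vertices-unique s))
             (Unique.map⁺ under-injective (vertices-unique t))
             λ (m , n) → disjoint (∈-map⁻ (under L) m) (∈-map⁻ (under R) n)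
  where
  disjoint : ∀ {v} → ∃[ u ] (u ∈ vertices s × v ≡ under L u) →
             ¬ (∃[ u ] (u ∈ vertices t × v ≡ under R u))
  disjoint (_ , _ , refl) (_ , _ , ())

-- Index intervals of power-of-two length and their halves.

size : ℕ → ℕ
size zero    = 1
size (suc k) = size k + size k

-- The first index of the lower (`L`) or upper (`R`) half of the interval of length `size (suc k)`
-- that starts at `i`.
shift : ℕ → Side → ℕ → ℕ
shift k L i = i
shift k R i = i + size k

record InBlock (k i a : ℕ) : Set where
  constructor _,_
  field
    lower : i ≤ a
    upper : a < i + size k

in-half : ∀ x → InBlock k (shift k x i) a → InBlock (suc k) i a
in-half {k} {i} L (l , u) = l , ≤-trans u (+-monoʳ-≤ i (m≤m+n (size k) (size k)))
in-half {k} {i} R (l , u) =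
  ≤-trans (m≤m+n i (size k)) l , ≤-trans u (≤-reflexive (+-assoc i (size k) (size k)))

choose-half : InBlock (suc k) i a → ∃[ x ] InBlock k (shift k x i) a
choose-half {k} {i} {a} (l , u) with a <? i + size k
... | yes u′ = L , l , u′
... | no ¬u′ = R , ≮⇒≥ ¬u′ , ≤-trans u (≤-reflexive (sym (+-assoc i (size k) (size k))))

halves-ordered : InBlock k (shift k L i) a → InBlock k (shift k R i) b → a < b
halves-ordered (_ , u) (l , _) = ≤-trans u l

same-half : ∀ x y → InBlock k (shift k x i) a → InBlock k (shift k y i) a → x ≡ y
same-half L L _ _ = refl
same-half R R _ _ = refl
same-half L R m n = contradiction (halves-ordered m n) (<-irrefl refl)
same-half R L m n = contradiction (halves-ordered n m) (<-irrefl refl)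

-- The recursive tasks and the coordinates of their leaves.

pattern ⇝ = zero

-- From a triangle, split as (triangle ⇝ square) ; triangle, to a square on its
-- rows: the two smaller triangles hold the diagonal cells of the upper and of
-- the lower half of the square.
rules : Fin 1 → List (FireRule (Fin 1))
rules ⇝ = (L ∷ L ∷ [] , fire ⇝ , L ∷ L ∷ [])
        ∷ (L ∷ L ∷ [] , fire ⇝ , L ∷ R ∷ [])
        ∷ (R ∷ []     , fire ⇝ , R ∷ L ∷ [])
        ∷ (R ∷ []     , fire ⇝ , R ∷ R ∷ [])
        ∷ []

open DAG rules

module Recursion (N : ℕ) where

  -- One scratch cell per column, so that columns never interfere.
  scratch : ℕ → Address
  scratch j = N + j

  -- D[j] holds garbage before row 0, where both branches of the selection
  -- therefore store the new candidate.
  keep : ℕ → ℕ → Address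
  keep zero    j = scratch j
  keep (suc _) j = j

  relax : ℕ → ℕ → Strand
  relax i j = add (scratch j) i (scratch j)
            ∷ select j (scratch j) j (scratch j) (keep i j)
            ∷ []

  -- On the diagonal, the otherwise useless weight labels the vertex.
  strand : ℕ → ℕ → Strand
  strand i j = weight (scratch j) i j ∷ (if does (i ≟ j) then [] else relax i j)

  -- Quarters on the same rows have disjoint columns, hence run in parallel; the lower ones continue
  -- the columns of the upper ones, hence wait for them.
  rect : (k i j : ℕ) → Task (Fin 1)
  rect zero    i j = leaf (strand i j)
  rect (suc k) i j = node seq (node par (quarter L L) (quarter L R))
                              (node par (quarter R L) (quarter R R))
    where
    quarter : Side → Side → Task (Fin 1)
    quarter x y = rect k (shift k x i) (shift k y j)

  tri : (k o : ℕ) → Task (Fin 1)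
  tri zero    o = leaf (strand o o)
  tri (suc k) o = node seq (node (fire ⇝) (tri k o) (rect k o (o + size k)))
                           (tri k (o + size k))

  -- A relation between paths and coordinates, so that matching on a derivation refines the path and
  -- the enclosing block together.
  data RectLeaf : (k i j : ℕ) → Path → (a b : ℕ) → Set where
    cell     : RectLeaf 0 i j [] i j
    quadrant : ∀ x y → RectLeaf k (shift k x i) (shift k y j) p a b →
               RectLeaf (suc k) i j (x ∷ y ∷ p) a b

  data TriLeaf : (k o : ℕ) → Path → (a b : ℕ) → Set where
    diagonal : TriLeaf 0 o [] o o
    early    : TriLeaf k o p a b → TriLeaf (suc k) o (L ∷ L ∷ p) a b
    cross    : RectLeaf k o (o + size k) p a b → TriLeaf (suc k) o (L ∷ R ∷ p) a b
    late     : TriLeaf k (o + size k) p a b → TriLeaf (suc k) o (R ∷ p) a b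

  rect-leaf⁺ : RectLeaf k i j p a b → subtask (rect k i j) p ≡ just (leaf (strand a b))
  rect-leaf⁺ cell             = refl
  rect-leaf⁺ (quadrant L L l) = rect-leaf⁺ l
  rect-leaf⁺ (quadrant L R l) = rect-leaf⁺ l
  rect-leaf⁺ (quadrant R L l) = rect-leaf⁺ l
  rect-leaf⁺ (quadrant R R l) = rect-leaf⁺ l

  rect-leaf⁻ : ∀ k {i j} p → subtask (rect k i j) p ≡ just (leaf c) →
               ∃[ a ] ∃[ b ] (RectLeaf k i j p a b × c ≡ strand a b)
  rect-leaf⁻ zero    []          refl = _ , _ , cell , refl
  rect-leaf⁻ zero    (_ ∷ _)     ()
  rect-leaf⁻ (suc k) []          ()
  rect-leaf⁻ (suc k) (L ∷ [])    ()
  rect-leaf⁻ (suc k) (R ∷ [])    ()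
  rect-leaf⁻ (suc k) (L ∷ L ∷ p) e with _ , _ , l , eq ← rect-leaf⁻ k p e =
    _ , _ , quadrant L L l , eq
  rect-leaf⁻ (suc k) (L ∷ R ∷ p) e with _ , _ , l , eq ← rect-leaf⁻ k p e =
    _ , _ , quadrant L R l , eq
  rect-leaf⁻ (suc k) (R ∷ L ∷ p) e with _ , _ , l , eq ← rect-leaf⁻ k p e =
    _ , _ , quadrant R L l , eq
  rect-leaf⁻ (suc k) (R ∷ R ∷ p) e with _ , _ , l , eq ← rect-leaf⁻ k p e =
    _ , _ , quadrant R R l , eq

  tri-leaf⁺ : TriLeaf k o p a b → subtask (tri k o) p ≡ just (leaf (strand a b))
  tri-leaf⁺ diagonal  = refl
  tri-leaf⁺ (early l) = tri-leaf⁺ l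
  tri-leaf⁺ (cross l) = rect-leaf⁺ l
  tri-leaf⁺ (late l)  = tri-leaf⁺ l

  tri-leaf⁻ : ∀ k {o} p → subtask (tri k o) p ≡ just (leaf c) →
              ∃[ a ] ∃[ b ] (TriLeaf k o p a b × c ≡ strand a b)
  tri-leaf⁻ zero    []          refl = _ , _ , diagonal , refl
  tri-leaf⁻ zero    (_ ∷ _)     ()
  tri-leaf⁻ (suc k) []          ()
  tri-leaf⁻ (suc k) (L ∷ [])    ()
  tri-leaf⁻ (suc k) (L ∷ L ∷ p) e with _ , _ , l , eq ← tri-leaf⁻ k p e  = _ , _ , early l , eq
  tri-leaf⁻ (suc k) (L ∷ R ∷ p) e with _ , _ , l , eq ← rect-leaf⁻ k p e = _ , _ , cross l , eq
  tri-leaf⁻ (suc k) (R ∷ p)     e with _ , _ , l , eq ← tri-leaf⁻ k p e  = _ , _ , late l , eq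

  rect-vertex : ∀ k {i j} → (p , c) ∈ vertices (rect k i j) →
                ∃[ a ] ∃[ b ] (RectLeaf k i j p a b × c ≡ strand a b)
  rect-vertex k v = rect-leaf⁻ k _ (vertex⇒leaf (rect k _ _) v)

  tri-vertex : ∀ k {o} → (p , c) ∈ vertices (tri k o) →
               ∃[ a ] ∃[ b ] (TriLeaf k o p a b × c ≡ strand a b)
  tri-vertex k v = tri-leaf⁻ k _ (vertex⇒leaf (tri k _) v)

  rect-row : RectLeaf k i j p a b → InBlock k i a
  rect-row {i = i} cell = ≤-refl , m<m+n i (s≤s z≤n)
  rect-row (quadrant x _ l) = in-half x (rect-row l)

  rect-column : RectLeaf k i j p a b → InBlock k j b
  rect-column {j = j} cell = ≤-refl , m<m+n j (s≤s z≤n)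
  rect-column (quadrant _ y l) = in-half y (rect-column l)

  tri-row : TriLeaf k o p a b → InBlock k o a
  tri-row {o = o} diagonal = ≤-refl , m<m+n o (s≤s z≤n)
  tri-row (early l) = in-half L (tri-row l)
  tri-row (cross l) = in-half L (rect-row l)
  tri-row (late l)  = in-half R (tri-row l)

  tri-column : TriLeaf k o p a b → InBlock k o b
  tri-column {o = o} diagonal = ≤-refl , m<m+n o (s≤s z≤n)
  tri-column (early l) = in-half L (tri-column l)
  tri-column (cross l) = in-half R (rect-column l)
  tri-column (late l)  = in-half R (tri-column l)

  tri-upper : TriLeaf k o p a b → a ≤ b
  tri-upper diagonal  = ≤-refl
  tri-upper (early l) = tri-upper l
  tri-upper (cross l) = <⇒≤ (halves-ordered (rect-row l) (rect-column l))
  tri-upper (late l)  = tri-upper l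

  -- Halving the row and the column interval in step yields the path, one quadrant per level.
  rect-exists : ∀ k → InBlock k i a → InBlock k j b → ∃[ p ] RectLeaf k i j p a b
  rect-exists {i} {a} {j} {b} zero (l , u) (l′ , u′)
    with refl ← ≤-antisym l (≤-pred (≤-trans u (≤-reflexive (+-comm i 1))))
       | refl ← ≤-antisym l′ (≤-pred (≤-trans u′ (≤-reflexive (+-comm j 1)))) = [] , cell
  rect-exists (suc k) m n with choose-half m | choose-half n
  ... | x , m′ | y , n′ with _ , l ← rect-exists k m′ n′ = _ , quadrant x y l

  tri-exists : ∀ k → a ≤ b → InBlock k o a → InBlock k o b → ∃[ p ] TriLeaf k o p a b
  tri-exists {a} {b} {o} zero le (l , u) (l′ , u′)
    with refl ← ≤-antisym l (≤-pred (≤-trans u (≤-reflexive (+-comm o 1))))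
       | refl ← ≤-antisym l′ (≤-pred (≤-trans u′ (≤-reflexive (+-comm o 1)))) = [] , diagonal
  tri-exists (suc k) le m n with choose-half m | choose-half n
  ... | L , m′ | L , n′ with _ , l ← tri-exists k le m′ n′ = _ , early l
  ... | L , m′ | R , n′ with _ , l ← rect-exists k m′ n′ = _ , cross l
  ... | R , m′ | L , n′ = contradiction le (<⇒≱ (halves-ordered n′ m′))
  ... | R , m′ | R , n′ with _ , l ← tri-exists k le m′ n′ = _ , late l

  rect-injective : RectLeaf k i j p a b → RectLeaf k i j q a b → p ≡ q
  rect-injective cell cell = refl
  rect-injective (quadrant x y l) (quadrant x′ y′ l′)
    with refl ← same-half x x′ (rect-row l) (rect-row l′)
       | refl ← same-half y y′ (rect-column l) (rect-column l′)
    with refl ← rect-injective l l′ = refl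

  -- The conclusion is arbitrary, so that impossible cases are closed whatever the goal.
  halves-disjoint : ∀ {A : Set} → InBlock k (shift k L i) a → InBlock k (shift k R i) a → A
  halves-disjoint m n with () ← same-half L R m n

  -- Any two of the three parts of a triangle differ in the half of the rows or of the columns.
  -- Coordinates therefore identify a vertex.
  tri-injective : TriLeaf k o p a b → TriLeaf k o q a b → p ≡ q
  tri-injective diagonal diagonal = refl
  tri-injective (early l) (early l′) with refl ← tri-injective l l′ = refl
  tri-injective (cross l) (cross l′) with refl ← rect-injective l l′ = refl
  tri-injective (late l) (late l′) with refl ← tri-injective l l′ = refl
  tri-injective (early l) (cross l′) = halves-disjoint (tri-column l) (rect-column l′)
  tri-injective (early l) (late l′)  = halves-disjoint (tri-column l) (tri-column l′)
  tri-injective (cross l) (early l′) = halves-disjoint (tri-column l′) (rect-column l)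
  tri-injective (cross l) (late l′)  = halves-disjoint (rect-row l) (tri-row l′)
  tri-injective (late l)  (early l′) = halves-disjoint (tri-column l′) (tri-column l)
  tri-injective (late l)  (cross l′) = halves-disjoint (rect-row l′) (tri-row l)

  -- Edges of the task in terms of coordinates.

  quadrant-edge : ∀ x y → Edge (rect k (shift k x i) (shift k y j)) p q →
                  Edge (rect (suc k) i j) (x ∷ y ∷ p) (x ∷ y ∷ q)
  quadrant-edge L L e = inˡ (inˡ e)
  quadrant-edge L R e = inˡ (inʳ e)
  quadrant-edge R L e = inʳ (inˡ e)
  quadrant-edge R R e = inʳ (inʳ e)

  -- Cells of one column never lie on opposite sides of a `par`; at the level that separates their
  -- rows, the `seq` orders all leaves.
  rect-column-edge : RectLeaf k i j p a b → RectLeaf k i j q a′ b → a < a′ → Edge (rect k i j) p q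
  rect-column-edge cell cell lt = contradiction lt (<-irrefl refl)
  rect-column-edge (quadrant x y l) (quadrant x′ y′ l′) lt
    with refl ← same-half y y′ (rect-column l) (rect-column l′) | x | x′
  ... | L | L = quadrant-edge L y (rect-column-edge l l′ lt)
  ... | R | R = quadrant-edge R y (rect-column-edge l l′ lt)
  ... | L | R = across (all-leaves (rect-leaf⁺ (quadrant L y l)) (rect-leaf⁺ (quadrant R y l′)))
  ... | R | L = contradiction lt (<-asym (halves-ordered (rect-row l′) (rect-row l)))

  -- Only the square and the last triangle share columns, and a `seq` stands between them.
  tri-column-edge : TriLeaf k o p a b → TriLeaf k o q a′ b → a < a′ → Edge (tri k o) p q
  tri-column-edge diagonal diagonal lt = contradiction lt (<-irrefl refl)
  tri-column-edge (early l) (early l′) lt = inˡ (inˡ (tri-column-edge l l′ lt))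
  tri-column-edge (cross l) (cross l′) lt = inˡ (inʳ (rect-column-edge l l′ lt))
  tri-column-edge (late l)  (late l′)  lt = inʳ (tri-column-edge l l′ lt)
  tri-column-edge (early l) (late l′)  lt = across (all-leaves (tri-leaf⁺ l) (tri-leaf⁺ l′))
  tri-column-edge (cross l) (late l′)  lt = across (all-leaves (rect-leaf⁺ l) (tri-leaf⁺ l′))
  tri-column-edge (early l) (cross l′) lt = halves-disjoint (tri-column l) (rect-column l′)
  tri-column-edge (cross l) (early l′) lt = halves-disjoint (tri-column l′) (rect-column l)
  tri-column-edge (late l)  (early l′) lt = halves-disjoint (tri-column l′) (tri-column l)
  tri-column-edge (late l) (cross l′) lt =
    contradiction lt (<-asym (halves-ordered (rect-row l′) (tri-row l)))

  -- Each half of the rows holds one smaller triangle, which fires at the two quadrants on these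
  -- rows: this gives the four rules. A cell of the square inside the triangle is never diagonal.
  fire-diagonal : TriLeaf k o p a a → RectLeaf k o j q a b →
                  Depends (fire ⇝) (tri k o) (rect k o j) p q
  fire-diagonal diagonal cell = two-leaves
  fire-diagonal (early l) (quadrant L L l′) = refine (here refl) refl refl (fire-diagonal l l′)
  fire-diagonal (early l) (quadrant L R l′) =
    refine (there (here refl)) refl refl (fire-diagonal l l′)
  fire-diagonal (late l)  (quadrant R L l′) =
    refine (there (there (here refl))) refl refl (fire-diagonal l l′)
  fire-diagonal (late l)  (quadrant R R l′) =
    refine (there (there (there (here refl)))) refl refl (fire-diagonal l l′)
  fire-diagonal (early l) (quadrant R _ l′) = halves-disjoint (tri-row l) (rect-row l′)
  fire-diagonal (late l)  (quadrant L _ l′) = halves-disjoint (rect-row l′) (tri-row l)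
  fire-diagonal (cross l) _ = halves-disjoint (rect-row l) (rect-column l)

  tri-diagonal-edge : TriLeaf k o p a a → TriLeaf k o q a b → a < b → Edge (tri k o) p q
  tri-diagonal-edge diagonal diagonal lt = contradiction lt (<-irrefl refl)
  tri-diagonal-edge (early l) (early l′) lt = inˡ (inˡ (tri-diagonal-edge l l′ lt))
  tri-diagonal-edge (early l) (cross l′) lt = inˡ (across (fire-diagonal l l′))
  tri-diagonal-edge (late l)  (late l′)  lt = inʳ (tri-diagonal-edge l l′ lt)
  tri-diagonal-edge (early l) (late l′)  lt = halves-disjoint (tri-row l) (tri-row l′)
  tri-diagonal-edge (late l)  (early l′) lt = halves-disjoint (tri-row l′) (tri-row l)
  tri-diagonal-edge (late l)  (cross l′) lt = halves-disjoint (rect-row l′) (tri-row l)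
  tri-diagonal-edge (cross l) _          lt = halves-disjoint (rect-row l) (rect-column l)

  rect-edge⁻ : RectLeaf k i j p a b → RectLeaf k i j q a′ b′ → Edge (rect k i j) p q → a < a′
  rect-edge⁻ cell cell ()
  rect-edge⁻ (quadrant L L l) (quadrant L L l′) (inˡ (inˡ e)) = rect-edge⁻ l l′ e
  rect-edge⁻ (quadrant L R l) (quadrant L R l′) (inˡ (inʳ e)) = rect-edge⁻ l l′ e
  rect-edge⁻ (quadrant R L l) (quadrant R L l′) (inʳ (inˡ e)) = rect-edge⁻ l l′ e
  rect-edge⁻ (quadrant R R l) (quadrant R R l′) (inʳ (inʳ e)) = rect-edge⁻ l l′ e
  rect-edge⁻ (quadrant L L l) (quadrant L R l′) (inˡ (across ()))
  rect-edge⁻ (quadrant R L l) (quadrant R R l′) (inʳ (across ()))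
  rect-edge⁻ (quadrant L _ l) (quadrant R _ l′) (across _) =
    halves-ordered (rect-row l) (rect-row l′)

  -- Refinement descends to the same rows in source and sink, and it never enters the square inside
  -- the triangle, so it ends at a diagonal cell.
  fire⁻ : ∀ k {o j p q} → Depends (fire ⇝) (tri k o) (rect k o j) p q →
          TriLeaf k o p a b → RectLeaf k o j q a′ b′ → a ≡ b × a ≡ a′
  fire⁻ zero    _ diagonal cell = refl , refl
  fire⁻ (suc k) (refine (here refl) refl refl d) (early l) (quadrant L L l′) = fire⁻ k d l l′
  fire⁻ (suc k) (refine (there (here refl)) refl refl d) (early l) (quadrant L R l′) =
    fire⁻ k d l l′
  fire⁻ (suc k) (refine (there (there (here refl))) refl refl d) (late l) (quadrant R L l′) =
    fire⁻ k d l l′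
  fire⁻ (suc k) (refine (there (there (there (here refl)))) refl refl d) (late l) (quadrant R R l′) =
    fire⁻ k d l l′

  -- The second alternative is a fire edge, from a diagonal cell to one off the diagonal; after it,
  -- the row has to increase.
  tri-edge⁻ : TriLeaf k o p a b → TriLeaf k o q a′ b′ → Edge (tri k o) p q →
              a < a′ ⊎ (a ≡ b × a ≡ a′ × a′ < b′)
  tri-edge⁻ (early l) (early l′) (inˡ (inˡ e)) = tri-edge⁻ l l′ e
  tri-edge⁻ (cross l) (cross l′) (inˡ (inʳ e)) = inj₁ (rect-edge⁻ l l′ e)
  tri-edge⁻ (late l)  (late l′)  (inʳ e)       = tri-edge⁻ l l′ e
  tri-edge⁻ (early l) (cross l′) (inˡ (across d)) with refl , refl ← fire⁻ _ d l l′ =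
    inj₂ (refl , refl , halves-ordered (rect-row l′) (rect-column l′))
  tri-edge⁻ (early l) (late l′) (across _) = inj₁ (halves-ordered (tri-row l) (tri-row l′))
  tri-edge⁻ (cross l) (late l′) (across _) = inj₁ (halves-ordered (rect-row l) (tri-row l′))

-- Span and races

-- By induction along a path, the accumulated cost is at most the potential of the last vertex.
span-potential : (t : Task (Fin 1)) (d : Vertex → ℕ) (m : ℕ) →
                 (∀ {v} → v ∈ vertices t → cost v ≤ d v × d v ≤ m) →
                 (∀ {u v} → u ∈ vertices t → v ∈ vertices t → t ⊢ u ⟶ v → d u + cost v ≤ d v) →
                 SpanAtMost t m
span-potential t d m bounded increases = span
  where
  after : ∀ v π → All (_∈ vertices t) (v ∷ π) → Linked (t ⊢_⟶_) (v ∷ π) →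
          d v + sum (map cost π) ≤ m
  after v [] (v∈ ∷ []) [-] = ≤-trans (≤-reflexive (+-identityʳ (d v))) (proj₂ (bounded v∈))
  after v (u ∷ π) (v∈ ∷ u∈ ∷ π∈) (e ∷ es) = begin
    d v + (cost u + sum (map cost π)) ≡⟨ +-assoc (d v) _ _ ⟨
    d v + cost u + sum (map cost π)   ≤⟨ +-monoˡ-≤ _ (increases v∈ u∈ e) ⟩
    d u + sum (map cost π)            ≤⟨ after u π (u∈ ∷ π∈) es ⟩
    m                                 ∎
    where open ≤-Reasoning

  span : SpanAtMost t m
  span []      _         _  = z≤n
  span (v ∷ π) (v∈ ∷ π∈) es =
    ≤-trans (+-monoˡ-≤ _ (proj₁ (bounded v∈))) (after v π (v∈ ∷ π∈) es)

-- Read off the labelling `weight`, so that the potential depends on the vertex alone.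
row : Strand → ℕ
row (weight _ i _ ∷ _) = i
row _                  = 0

-- Each row has a budget of 6. A diagonal strand has length 1 and reaches 2, which leaves room for
-- the 3 instructions of a vertex off the diagonal, placed at 6. Doubling the length lets a vertex
-- pay for itself after a change of row.
potential : Vertex → ℕ
potential (_ , c) = 6 * row c + 2 * length c

module Analysis (N : ℕ) where
  open Recursion N

  -- The decision inside `strand` is resolved here once; the motive `P` transfers the result to
  -- every property of strands.
  strand-elim : ∀ {ℓ} (P : Strand → Set ℓ) a b →
                (a ≡ b → P (weight (scratch b) a b ∷ [])) →
                (a ≢ b → P (weight (scratch b) a b ∷ relax a b)) →
                P (strand a b)
  strand-elim P a b diag upper with a ≟ b
  ... | yes eq rewrite dec-true (a ≟ b) eq = diag eq
  ... | no neq rewrite dec-false (a ≟ b) neq = upper neq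

  cost-strand : ∀ a b → length (strand a b) ≤ 3
  cost-strand a b = strand-elim (λ c → length c ≤ 3) a b (λ _ → s≤s z≤n) (λ _ → ≤-refl)

  -- The inequalities record that a diagonal vertex touches nothing but its scratch cell.
  data Access (a b : ℕ) : Address → Set where
    temporary : Access a b (scratch b)
    operand   : a ≢ b → Access a b a
    output    : a ≢ b → Access a b b

  access-keep : a ≢ b → Access a b (keep a b)
  access-keep {zero}  neq = temporary
  access-keep {suc a} neq = output neq

  trace-accesses : ∀ a b → All (Access a b) (trace (strand a b))
  trace-accesses a b = strand-elim (λ c → All (Access a b) (trace c)) a b
    (λ _ → temporary ∷ [])
    (λ neq → temporary ∷ operand neq ∷ temporary ∷ temporary ∷
             temporary ∷ output neq ∷ temporary ∷ access-keep neq ∷ output neq ∷ [])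

  touch-accesses : ∀ a b → All (Access a b) (reads (strand a b) ++ writes (strand a b))
  touch-accesses a b = strand-elim (λ c → All (Access a b) (reads c ++ writes c)) a b
    (λ _ → temporary ∷ [])
    (λ neq → operand neq ∷ temporary ∷ temporary ∷ output neq ∷ temporary ∷ access-keep neq ∷
             temporary ∷ temporary ∷ output neq ∷ [])

  write-targets : ∀ a b → All (λ d → d ≡ scratch b ⊎ a ≢ b × d ≡ b) (writes (strand a b))
  write-targets a b = strand-elim (λ c → All (λ d → d ≡ scratch b ⊎ a ≢ b × d ≡ b) (writes c)) a b
    (λ _ → inj₁ refl ∷ [])
    (λ neq → inj₁ refl ∷ inj₁ refl ∷ inj₂ (neq , refl) ∷ [])

  -- Results lie below `N` and scratch cells do not, so a conflict is either within one column or
  -- between column `b` and row `b`. Column edges settle the former, the diagonal vertex of `b` the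
  -- latter.
  tri-race-free : ∀ k → size k ≡ N → RaceFree (tri k 0)
  tri-race-free k refl {p , _} {q , _} u∈ v∈ p≢q w∈ w∈′
    with a , b , l , refl ← tri-vertex k u∈ | a′ , b′ , l′ , refl ← tri-vertex k v∈ =
    conflict (All.lookup (write-targets a b) w∈) (All.lookup (touch-accesses a′ b′) w∈′)
    where
    scratch≢ : ∀ {x} y → x < N → x ≢ scratch y
    scratch≢ y x<N refl = contradiction (≤-<-trans (m≤m+n N y) x<N) (<-irrefl refl)

    ordered : Set
    ordered = Precedes (tri k 0) (p , strand a b) (q , strand a′ b′) ⊎
              Precedes (tri k 0) (q , strand a′ b′) (p , strand a b)

    same-column : b ≡ b′ → ordered
    same-column refl with <-cmp a a′
    ... | tri< lt _ _ = inj₁ [ tri-column-edge l l′ lt ]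
    ... | tri≈ _ refl _ = contradiction (tri-injective l l′) p≢q
    ... | tri> _ _ gt = inj₂ [ tri-column-edge l′ l gt ]

    -- The diagonal vertex of column b relays the final value of D[b] to row b.
    column-then-row : a ≢ b → b ≡ a′ → a′ ≢ b′ → ordered
    column-then-row neq refl neq′
      with _ , m ← tri-exists k ≤-refl (tri-row l′) (tri-row l′) =
      inj₁ (tri-column-edge l m (≤∧≢⇒< (tri-upper l) neq) ∷
            [ tri-diagonal-edge m l′ (≤∧≢⇒< (tri-upper l′) neq′) ])

    conflict : ∀ {w} → w ≡ scratch b ⊎ a ≢ b × w ≡ b → Access a′ b′ w → ordered
    conflict (inj₁ eq) temporary = same-column (sym (+-cancelˡ-≡ N _ _ eq))
    conflict (inj₁ eq) (operand _) = contradiction eq (scratch≢ b (InBlock.upper (tri-row l′)))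
    conflict (inj₁ eq) (output _)  = contradiction eq (scratch≢ b (InBlock.upper (tri-column l′)))
    conflict (inj₂ (_ , eq)) temporary = contradiction (sym eq) (scratch≢ b′ (InBlock.upper (tri-column l)))
    conflict (inj₂ (neq , refl)) (operand neq′) = column-then-row neq refl neq′
    conflict (inj₂ (_ , refl))   (output _)     = same-column refl

  potential-strand : ∀ a b → length (strand a b) ≤ 6 * a + 2 * length (strand a b) ×
                             6 * a + 2 * length (strand a b) ≤ 6 * suc a
  potential-strand a b =
    ≤-trans (m≤m+n len (len + 0)) (m≤n+m (2 * len) (6 * a)) ,
    (begin
      6 * a + 2 * len ≤⟨ +-monoʳ-≤ (6 * a) (*-monoʳ-≤ 2 (cost-strand a b)) ⟩
      6 * a + 6       ≡⟨ +-comm (6 * a) 6 ⟩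
      6 + 6 * a       ≡⟨ *-suc 6 a ⟨
      6 * suc a       ∎)
    where
    open ≤-Reasoning
    len = length (strand a b)

  potential-increases : a < a′ ⊎ (a ≡ b × a ≡ a′ × a′ < b′) →
                        6 * a + 2 * length (strand a b) + length (strand a′ b′) ≤
                        6 * a′ + 2 * length (strand a′ b′)
  potential-increases {a} {b = b} (inj₁ lt) =
    +-mono-≤ (≤-trans (proj₂ (potential-strand a b)) (*-monoʳ-≤ 6 lt)) (m≤m+n _ _)
  potential-increases {a} {b′ = b′} (inj₂ (refl , refl , lt)) =
    strand-elim (λ c → 6 * a + 2 * length c + length (strand a b′) ≤
                       6 * a + 2 * length (strand a b′)) a a
      (λ _ → strand-elim (λ c → 6 * a + 2 + length c ≤ 6 * a + 2 * length c) a b′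
        (λ eq → contradiction lt (<-irrefl eq))
        (λ _ → ≤-trans (≤-reflexive (+-assoc (6 * a) 2 3)) (+-monoʳ-≤ (6 * a) (n≤1+n 5))))
      (λ neq → contradiction refl neq)

  tri-span : ∀ k → size k ≡ N → SpanAtMost (tri k 0) (6 * N)
  tri-span k refl = span-potential (tri k 0) potential (6 * N) bounded increases
    where
    bounded : ∀ {v} → v ∈ vertices (tri k 0) → cost v ≤ potential v × potential v ≤ 6 * N
    bounded v∈ with a , b , l , refl ← tri-vertex k v∈ =
      proj₁ (potential-strand a b) ,
      ≤-trans (proj₂ (potential-strand a b)) (*-monoʳ-≤ 6 (InBlock.upper (tri-row l)))

    increases : ∀ {u v} → u ∈ vertices (tri k 0) → v ∈ vertices (tri k 0) →
                tri k 0 ⊢ u ⟶ v → potential u + cost v ≤ potential v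
    increases u∈ v∈ e
      with _ , _ , l , refl ← tri-vertex k u∈ | _ , _ , l′ , refl ← tri-vertex k v∈ =
      potential-increases (tri-edge⁻ l l′ e)

-- Additive measures along the recursion.

work-node : ∀ {F} κ (s t : Task F) → work (node κ s t) ≡ work s + work t
work-node κ s t = begin
  sum (map cost (map (under L) (vertices s) ++ map (under R) (vertices t)))
    ≡⟨ cong sum (map-++ cost (map (under L) (vertices s)) _) ⟩
  sum (map cost (map (under L) (vertices s)) ++ map cost (map (under R) (vertices t)))
    ≡⟨ sum-++ (map cost (map (under L) (vertices s))) _ ⟩
  sum (map cost (map (under L) (vertices s))) + sum (map cost (map (under R) (vertices t)))
    ≡⟨ cong₂ (λ xs ys → sum xs + sum ys) (map-∘ (vertices s)) (map-∘ (vertices t)) ⟨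
  work s + work t ∎
  where open ≡-Reasoning

serialTrace-node : ∀ {F} κ (s t : Task F) →
                   serialTrace (node κ s t) ≡ serialTrace s ++ serialTrace t
serialTrace-node κ s t = begin
  concatMap (trace ∘ proj₂) (map (under L) (vertices s) ++ map (under R) (vertices t))
    ≡⟨ concatMap-++ (trace ∘ proj₂) (map (under L) (vertices s)) _ ⟩
  concatMap (trace ∘ proj₂) (map (under L) (vertices s)) ++
  concatMap (trace ∘ proj₂) (map (under R) (vertices t))
    ≡⟨ cong₂ _++_ (concatMap-map (trace ∘ proj₂) (under L) (vertices s))
                  (concatMap-map (trace ∘ proj₂) (under R) (vertices t)) ⟩
  serialTrace s ++ serialTrace t ∎
  where open ≡-Reasoning

serialTrace⁻ : ∀ {F} (t : Task F) → a ∈ serialTrace t →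
               ∃[ p ] ∃[ c ] ((p , c) ∈ vertices t × a ∈ trace c)
serialTrace⁻ t a∈
  with (p , c) , v∈ , a∈c ← find (∈-concatMap⁻ (trace ∘ proj₂) {xs = vertices t} a∈) =
  p , c , v∈ , a∈c

0<size : ∀ k → 0 < size k
0<size zero    = s≤s z≤n
0<size (suc k) = ≤-trans (0<size k) (m≤m+n (size k) (size k))

size-+ : ∀ d k → size (d + k) ≡ size d * size k
size-+ zero    k = sym (+-identityʳ (size k))
size-+ (suc d) k = trans (cong₂ _+_ (size-+ d k) (size-+ d k))
                         (sym (*-distribʳ-+ (size k) (size d) (size d)))

size-mono-≤ : j ≤ k → size j ≤ size k
size-mono-≤ {k = k} z≤n     = 0<size k
size-mono-≤ (s≤s le) = +-mono-≤ (size-mono-≤ le) (size-mono-≤ le)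

-- The power is doubled only when `suc n` reaches it, which keeps it within `suc (n + n)`.
power-above : ∀ n → ∃[ k ] (n < size k × size k ≤ suc (n + n))
power-above zero = 0 , s≤s z≤n , s≤s z≤n
power-above (suc n) with power-above n
... | k , l , u with suc n <? size k
...   | yes l′ = k , l′ , ≤-trans u (s≤s (+-mono-≤ (n≤1+n n) (n≤1+n n)))
...   | no ¬l′ with eq ← ≤-antisym l (≮⇒≥ ¬l′) =
  suc k , ≤-trans (≤-reflexive (cong suc eq)) (+-monoˡ-≤ (size k) (0<size k)) ,
  ≤-trans (≤-reflexive (sym (cong₂ _+_ eq eq))) (n≤1+n _)

-- Shared by work and cache misses. Both add up over the operands of a construct, so a bound for the
-- subtasks at level `k` is multiplied by at most the number `size d * size d` of blocks.
module Growth (N : ℕ) (P : Task (Fin 1) → ℕ → Set)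
  (compose : ∀ {κ s t m n} → P s m → P t n → P (node κ s t) (m + n))
  (weaken : ∀ {t m n} → m ≤ n → P t m → P t n) where

  open Recursion N

  quadruple : ∀ x m → ((x * x * m + x * x * m) + (x * x * m + x * x * m)) ≡ (x + x) * (x + x) * m
  quadruple = solve-∀

  rect-growth : ∀ m → (∀ i j → P (rect k i j) m) →
                ∀ d i j → P (rect (d + k) i j) (size d * size d * m)
  rect-growth m base zero    i j = weaken (≤-reflexive (sym (+-identityʳ m))) (base i j)
  rect-growth m base (suc d) i j = weaken (≤-reflexive (quadruple (size d) m))
    (compose (compose (rect-growth m base d _ _) (rect-growth m base d _ _))
             (compose (rect-growth m base d _ _) (rect-growth m base d _ _)))

  tri-growth : ∀ m → (∀ i j → P (rect k i j) m) → (∀ o → P (tri k o) m) →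
               ∀ d o → P (tri (d + k) o) (size d * size d * m)
  tri-growth m rect-base base zero    o = weaken (≤-reflexive (sym (+-identityʳ m))) (base o)
  tri-growth m rect-base base (suc d) o = weaken
    -- Two triangles and a square make three of the four quarters.
    (≤-trans (+-monoʳ-≤ (quarter + quarter) (m≤m+n quarter quarter))
             (≤-reflexive (quadruple (size d) m)))
    (compose (compose (tri-growth m rect-base base d _) (rect-growth m rect-base d _ _))
             (tri-growth m rect-base base d _))
    where
    quarter = size d * size d * m

  tri-quadratic : ∀ m → (∀ a b → P (leaf (strand a b)) m) →
                  ∀ k o → P (tri k o) (size k * size k * m)
  tri-quadratic m base k o = subst (λ k′ → P (tri k′ o) (size k * size k * m)) (+-identityʳ k)
    (tri-growth {0} m base (λ o → base o o) k o)

-- Serving requests from the cache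

-- Serves hides the final cache; quantifying over continuations makes the
-- bounds additive.
Cheap : ℕ → List ℕ → ℕ → Set
Cheap K ls m = ∀ C rest r → (∀ C′ → ∃[ q ] (q ≤ r × Serves K C′ rest q)) →
               ∃[ q ] (q ≤ m + r × Serves K C (ls ++ rest) q)

-- The requests `ls′` are handed to `ls` as part of its continuation.
cheap-++ : Cheap K ls m → Cheap K ls′ n → Cheap K (ls ++ ls′) (m + n)
cheap-++ {K} {ls} {m} {ls′} {n} f g C rest r continue
  with q , le , s ← f C (ls′ ++ rest) (n + r) (λ C′ → g C′ rest r continue) =
  q , ≤-trans le (≤-reflexive (sym (+-assoc m n r))) ,
  subst (λ xs → Serves K C xs q) (sym (++-assoc ls ls′ rest)) s

cheap-weaken : m ≤ n → Cheap K ls m → Cheap K ls n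
cheap-weaken le f C rest r continue with q , le′ , s ← f C rest r continue =
  q , ≤-trans le′ (+-monoˡ-≤ r le) , s

-- Every request is served by a miss that leaves just its own line in the cache, so room for one
-- line suffices.
cheap-length : 1 ≤ K → ∀ ls → Cheap K ls (length ls)
cheap-length 1≤K []       C rest r continue = continue C
cheap-length 1≤K (l ∷ ls) C rest r continue
  with q , le , s ← cheap-length 1≤K ls (l ∷ []) rest r continue =
  suc q , s≤s le , miss (here refl) (λ { (here refl) → here refl ; (there ()) }) 1≤K s

∈-fetch : ∀ {l l′ : ℕ} {C₀} A {B} → l′ ∈ C₀ ⊎ l′ ∈ A ++ l ∷ B → l′ ∈ l ∷ C₀ ⊎ l′ ∈ A ++ B
∈-fetch A (inj₁ m) = inj₁ (there m)
∈-fetch A (inj₂ m) with ∈-++⁻ A m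
... | inj₁ m′           = inj₂ (∈-++⁺ˡ m′)
... | inj₂ (here refl)  = inj₁ (here refl)
... | inj₂ (there m′)   = inj₂ (∈-++⁺ʳ A m′)

-- C₀ holds the lines already fetched, U those still to be fetched.
serve-footprint : ∀ ls {C₀ U rest} → All (λ l → l ∈ C₀ ⊎ l ∈ U) ls →
                  C₀ ⊆ C → length C₀ + length U ≤ K →
                  (∀ C′ → ∃[ q ] (q ≤ r × Serves K C′ rest q)) →
                  ∃[ q ] (q ≤ length U + r × Serves K C (ls ++ rest) q)
serve-footprint {C} [] {U = U} [] _ _ continue with q , le , s ← continue C =
  q , m≤n⇒m≤o+n (length U) le , s
serve-footprint (l ∷ ls) (inj₁ l∈ ∷ all) sub le continue
  with q , le′ , s ← serve-footprint ls all sub le continue = q , le′ , hit (sub l∈) s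
serve-footprint {r = r} (l ∷ ls) {C₀} (inj₂ l∈ ∷ all) sub le continue
  with A , B , refl ← ∈-∃++ l∈
  with eq ← trans (length-++ A {l ∷ B})
                  (trans (+-suc (length A) (length B)) (cong suc (sym (length-++ A {B}))))
  with le₁ ← ≤-trans (≤-reflexive (sym (trans (cong (length C₀ +_) eq) (+-suc (length C₀) _)))) le
  with q , le′ , s ←
    serve-footprint ls {l ∷ C₀} {A ++ B} (All.map (∈-fetch A) all) (λ m → m) le₁ continue =
  suc q , ≤-trans (s≤s le′) (≤-reflexive (cong (_+ r) (sym eq))) ,
  miss (here refl) (∷⁺ʳ l sub) (≤-trans (m≤m+n _ _) le₁) s

-- As `U` fits as a whole, no line of it is evicted before the end of `ls`. Nothing is assumed to be
-- cached at the start.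
cheap-footprint : ∀ U → length U ≤ K → (∀ {l} → l ∈ ls → l ∈ U) → Cheap K ls (length U)
cheap-footprint {ls = ls} U le sub C rest r continue =
  serve-footprint ls {[]} (All.tabulate (λ l∈ → inj₂ (sub l∈))) (λ ()) le continue

-- Cache lines met by an interval.

module Lines (B : ℕ) .{{_ : NonZero B}} where

  -- The `+ 2` allows for the lines that an unaligned interval meets only in part.
  segment : ℕ → ℕ → List ℕ
  segment i s = map (i / B +_) (upTo (s / B + 2))

  length-segment : ∀ i s → length (segment i s) ≡ s / B + 2
  length-segment i s = trans (length-map _ (upTo (s / B + 2))) (length-upTo (s / B + 2))

  m<[m/B+1]*B : ∀ m → m < (m / B + 1) * B
  m<[m/B+1]*B m = ≰⇒> λ le → <-irrefl refl (begin-strict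
    m / B                       <⟨ n<1+n _ ⟩
    suc (m / B)                 ≡⟨ +-comm 1 (m / B) ⟩
    m / B + 1                   ≡⟨ m*n/n≡m (m / B + 1) B ⟨
    (m / B + 1) * B / B         ≤⟨ /-monoˡ-≤ B le ⟩
    m / B                       ∎)
    where open ≤-Reasoning

  ∈-segment : InBlock k i a → a / B ∈ segment i (size k)
  ∈-segment {k} {i} {a} (l , u) = subst (_∈ segment i (size k)) (m+[n∸m]≡n (/-monoˡ-≤ B l))
    (∈-map⁺ (i / B +_) (∈-upTo⁺ offset))
    where
    open ≤-Reasoning
    rearrange : ∀ x y B → (x + 1) * B + (y + 1) * B ≡ (x + (y + 2)) * B
    rearrange = solve-∀
    offset : a / B ∸ i / B < size k / B + 2
    offset = +-cancelˡ-< (i / B) _ _ (begin-strict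
      i / B + (a / B ∸ i / B)    ≡⟨ m+[n∸m]≡n (/-monoˡ-≤ B l) ⟩
      a / B                      <⟨ m<n*o⇒m/o<n (begin-strict
        a                                            <⟨ u ⟩
        i + size k
          ≤⟨ +-mono-≤ (<⇒≤ (m<[m/B+1]*B i)) (<⇒≤ (m<[m/B+1]*B (size k))) ⟩
        (i / B + 1) * B + (size k / B + 1) * B       ≡⟨ rearrange (i / B) (size k / B) B ⟩
        (i / B + (size k / B + 2)) * B               ∎) ⟩
      i / B + (size k / B + 2)   ∎)

-- Work, space and cache misses of the triangle.

module Resources (N : ℕ) where
  open Recursion N
  open Analysis N

  tri-work : ∀ k o → work (tri k o) ≤ size k * size k * 3
  tri-work = tri-quadratic 3 λ a b → ≤-trans (≤-reflexive (+-identityʳ _)) (cost-strand a b)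
    where
    open Growth N (λ t m → work t ≤ m)
      (λ {κ} {s} {t} f g → ≤-trans (≤-reflexive (work-node κ s t)) (+-mono-≤ f g))
      (λ le f → ≤-trans f le)

  tri-space : ∀ k → size k ≡ N → SpaceAtMost (tri k 0) (N + N)
  tri-space k refl = All.tabulate λ w∈ → bounded (serialTrace⁻ (tri k 0) w∈)
    where
    below : ∀ {b} → b < N → b < N + N
    below b<N = ≤-trans b<N (m≤m+n N N)

    reach : ∀ {p a b w} → TriLeaf k 0 p a b → Access a b w → w < N + N
    reach l temporary   = +-monoʳ-< N (InBlock.upper (tri-column l))
    reach l (operand _) = below (InBlock.upper (tri-row l))
    reach l (output _)  = below (InBlock.upper (tri-column l))

    bounded : ∀ {w} → ∃[ p ] ∃[ c ] ((p , c) ∈ vertices (tri k 0) × w ∈ trace c) → w < N + N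
    bounded (p , _ , v∈ , w∈) with a , b , l , refl ← tri-vertex k v∈ =
      reach l (All.lookup (trace-accesses a b) w∈)

  module Cached (M B : ℕ) .{{_ : NonZero B}} where
    open Lines B

    lines : Task (Fin 1) → List ℕ
    lines t = map (_/ B) (serialTrace t)

    CheapTask : Task (Fin 1) → ℕ → Set
    CheapTask t = Cheap (M / B) (lines t)

    open Growth N CheapTask
      (λ {κ} {s} {t} {m} {n} f g → subst (λ ls → Cheap (M / B) ls (m + n))
        (sym (trans (cong (map (_/ B)) (serialTrace-node κ s t)) (map-++ (_/ B) (serialTrace s) _)))
        (cheap-++ f g))
      cheap-weaken

    cheap-misses : ∀ t → CheapTask t m → MissesAtMost t M B m
    cheap-misses {m} t f with q , le , s ← f [] [] 0 (λ C → 0 , z≤n , done) =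
      q , ≤-trans le (≤-reflexive (+-identityʳ m)) ,
      subst (λ ls → Serves (M / B) [] ls q) (++-identityʳ (lines t)) s

    -- Operands are indexed by rows, results and scratch cells by columns: a block of `s * s` cells
    -- works on just three intervals of length `s`.
    region : (s i j : ℕ) → List ℕ
    region s i j = segment i s ++ segment j s ++ segment (scratch j) s

    length-region : ∀ s i j → length (region s i j) ≡ 3 * (s / B + 2)
    length-region s i j
      rewrite length-++ (segment i s) {segment j s ++ segment (scratch j) s}
            | length-++ (segment j s) {segment (scratch j) s}
            | length-segment i s | length-segment j s | length-segment (scratch j) s
            | +-identityʳ (s / B + 2) = refl

    scratch-block : InBlock k j b → InBlock k (scratch j) (scratch b)
    scratch-block (l , u) =
      +-monoʳ-≤ N l , ≤-trans (+-monoʳ-< N u) (≤-reflexive (sym (+-assoc N _ _)))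

    access-region : ∀ {w} → InBlock k i a → InBlock k j b → Access a b w →
                    w / B ∈ region (size k) i j
    access-region {k} {i} {j = j} m n temporary =
      ∈-++⁺ʳ (segment i (size k)) (∈-++⁺ʳ (segment j (size k)) (∈-segment (scratch-block n)))
    access-region m n (operand _) = ∈-++⁺ˡ (∈-segment m)
    access-region {k} {i} m n (output _) = ∈-++⁺ʳ (segment i (size k)) (∈-++⁺ˡ (∈-segment n))

    cheap-region : ∀ k t i j →
      (∀ {p c} → (p , c) ∈ vertices t →
        ∃[ a ] ∃[ b ] (InBlock k i a × InBlock k j b × c ≡ strand a b)) →
      3 * (size k / B + 2) ≤ M / B → CheapTask t (3 * (size k / B + 2))
    cheap-region k t i j inside fits = subst (CheapTask t) (length-region (size k) i j)
      (cheap-footprint (region (size k) i j)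
        (≤-trans (≤-reflexive (length-region (size k) i j)) fits) covers)
      where
      covers : ∀ {l} → l ∈ lines t → l ∈ region (size k) i j
      covers l∈ with w , w∈ , refl ← ∈-map⁻ (_/ B) l∈
                with p , c , v∈ , w∈c ← serialTrace⁻ t w∈
                with a , b , m , n , refl ← inside v∈ =
        access-region m n (All.lookup (trace-accesses a b) w∈c)

    -- The recursion is cut at level `k`, where every subtask, square or triangle, is charged for
    -- loading its footprint once.
    blocked-misses : ∀ d k → 3 * (size k / B + 2) ≤ M / B →
                     MissesAtMost (tri (d + k) 0) M B (size d * size d * (3 * (size k / B + 2)))
    blocked-misses d k fits = cheap-misses (tri (d + k) 0) (tri-growth _ rect-cheap tri-cheap d 0)
      where
      rect-cheap : ∀ i j → CheapTask (rect k i j) (3 * (size k / B + 2))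
      rect-cheap i j = cheap-region k (rect k i j) i j
        (λ v∈ → let a , b , l , eq = rect-vertex k v∈ in
          a , b , rect-row l , rect-column l , eq) fits

      tri-cheap : ∀ o → CheapTask (tri k o) (3 * (size k / B + 2))
      tri-cheap o = cheap-region k (tri k o) o o
        (λ v∈ → let a , b , l , eq = tri-vertex k v∈ in
          a , b , tri-row l , tri-column l , eq) fits

    -- Nine accesses: one by `weight`, three by `add` and five by `select`.
    trace-length : ∀ a b → length (lines (leaf (strand a b))) ≤ 9
    trace-length a b = strand-elim (λ c → length (lines (leaf c)) ≤ 9) a b
      (λ _ → s≤s z≤n) (λ _ → ≤-refl)

    trivial-misses : ∀ k → 1 ≤ M / B → MissesAtMost (tri k 0) M B (size k * size k * 9)
    trivial-misses k 1≤ = cheap-misses (tri k 0)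
      (tri-quadratic 9 (λ a b → cheap-weaken (trace-length a b) (cheap-length 1≤ _)) k 0)

-- The algorithm and its asymptotic bounds.

level : ℕ → ℕ
level n = proj₁ (power-above n)

n<size : ∀ n → n < size (level n)
n<size n = proj₁ (proj₂ (power-above n))

size≤3n : 1 ≤ n → size (level n) ≤ 3 * n
size≤3n {n} 1≤n = begin
  size (level n) ≤⟨ proj₂ (proj₂ (power-above n)) ⟩
  suc (n + n)    ≤⟨ +-monoˡ-≤ (n + n) 1≤n ⟩
  n + (n + n)    ≡⟨ cong (λ m → n + (n + m)) (+-identityʳ n) ⟨
  3 * n          ∎
  where open ≤-Reasoning

-- The triangle has to cover the `suc n` indices from 0 to `n`; its side is rounded up to a power of
-- two, and the scratch cells start right behind its columns.
algorithm : NDAlgorithm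
algorithm = record
  { fireTypes = 1
  ; rules     = rules
  ; task      = λ n → Recursion.tri (size (level n)) (level n) 0
  }

linear-time : Costs.LinearTime algorithm
-- Six per row, on at most `3 * n` rows.
linear-time = 18 , λ n 1≤n → widen
  (≤-trans (*-monoʳ-≤ 6 (size≤3n 1≤n)) (≤-reflexive (sym (*-assoc 6 3 n))))
  (Analysis.tri-span _ (level n) refl)
  where
  widen : ∀ {t m n} → m ≤ n → SpanAtMost t m → SpanAtMost t n
  widen le span π π∈ es = ≤-trans (span π π∈ es) le

quadratic-work : Costs.QuadraticWork algorithm
-- Three instructions per cell, in a square of side at most `3 * n`.
quadratic-work = 27 , λ n 1≤n → begin
  work (NDAlgorithm.task algorithm n)     ≤⟨ Resources.tri-work _ (level n) 0 ⟩
  size (level n) * size (level n) * 3     ≤⟨ *-monoˡ-≤ 3 (*-mono-≤ (size≤3n 1≤n) (size≤3n 1≤n)) ⟩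
  (3 * n) * (3 * n) * 3                   ≡⟨ expand n ⟩
  27 * (n * n)                            ∎
  where
  open ≤-Reasoning
  expand : ∀ n → (3 * n) * (3 * n) * 3 ≡ 27 * (n * n)
  expand = solve-∀

linear-space : Costs.LinearSpace algorithm
linear-space = 6 , λ n 1≤n → All.map
  (λ lt → ≤-trans lt (≤-trans (+-mono-≤ (size≤3n 1≤n) (size≤3n 1≤n))
                              (≤-reflexive (sym (*-distribʳ-+ n 3 3)))))
  (Resources.tri-space _ (level n) refl)

-- A footprint takes at most `3 * S + 6 * B` cells when counted in full lines. Half of the cache is
-- reserved for each summand: rounding `M / 18` to a power of two at most triples it, so
-- `6 * S ≤ M`, and `12 * B ≤ M` follows from the hypothesis.
module LargeCache (M B : ℕ) .{{_ : NonZero B}} (18B≤M : 18 * B ≤ M) where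
  open ≤-Reasoning

  block : ℕ
  block = proj₁ (power-above (M / 18))

  S : ℕ
  S = size block

  6S≤M : 6 * S ≤ M
  6S≤M = begin
    6 * S                            ≤⟨ *-monoʳ-≤ 6 (proj₂ (proj₂ (power-above (M / 18)))) ⟩
    6 * (1 + (M / 18 + M / 18))      ≤⟨ *-monoʳ-≤ 6 (+-monoˡ-≤ _ 1≤M/18) ⟩
    6 * (M / 18 + (M / 18 + M / 18)) ≡⟨ collect (M / 18) ⟩
    M / 18 * 18                      ≤⟨ m/n*n≤m M 18 ⟩
    M                                ∎
    where
    1≤M/18 : 1 ≤ M / 18
    1≤M/18 = /-monoˡ-≤ 18 (≤-trans (*-monoʳ-≤ 18 (>-nonZero⁻¹ B)) 18B≤M)

    collect : ∀ x → 6 * (x + (x + x)) ≡ x * 18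
    collect = solve-∀

  M≤18S : M ≤ 18 * S
  M≤18S = begin
    M                  ≤⟨ <⇒≤ (Lines.m<[m/B+1]*B 18 M) ⟩
    (M / 18 + 1) * 18  ≡⟨ *-comm (M / 18 + 1) 18 ⟩
    18 * (M / 18 + 1)  ≡⟨ cong (18 *_) (+-comm (M / 18) 1) ⟩
    18 * suc (M / 18)  ≤⟨ *-monoʳ-≤ 18 (proj₁ (proj₂ (power-above (M / 18)))) ⟩
    18 * S             ∎

  B≤S : B ≤ S
  B≤S = *-cancelˡ-≤ 18 (≤-trans 18B≤M M≤18S)

  footprint*B : 3 * (S / B + 2) * B ≤ 3 * S + 6 * B
  footprint*B = begin
    3 * (S / B + 2) * B        ≡⟨ expand (S / B) B ⟩
    3 * (S / B * B) + 6 * B    ≤⟨ +-monoˡ-≤ (6 * B) (*-monoʳ-≤ 3 (m/n*n≤m S B)) ⟩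
    3 * S + 6 * B              ∎
    where
    expand : ∀ x B → 3 * (x + 2) * B ≡ 3 * (x * B) + 6 * B
    expand = solve-∀

  fits : 3 * (S / B + 2) ≤ M / B
  fits = begin
    3 * (S / B + 2)         ≡⟨ m*n/n≡m (3 * (S / B + 2)) B ⟨
    3 * (S / B + 2) * B / B ≤⟨ /-monoˡ-≤ B (≤-trans footprint*B (*-cancelˡ-≤ 2 (begin
      2 * (3 * S + 6 * B)      ≡⟨ double S B ⟩
      6 * S + 12 * B           ≤⟨ +-mono-≤ 6S≤M (≤-trans (*-monoˡ-≤ B (m≤m+n 12 6)) 18B≤M) ⟩
      M + M                    ≡⟨ cong (M +_) (+-identityʳ M) ⟨
      2 * M                    ∎))) ⟩
    M / B                   ∎
    where
    double : ∀ s b → 2 * (3 * s + 6 * b) ≡ 6 * s + 12 * b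
    double = solve-∀

  -- Makes `level n ∸ block` a true difference. Otherwise the whole triangle, of side above `n`,
  -- would be smaller than a block, whose side is at most `M`.
  block≤level : ∀ n → M ≤ n → block ≤ level n
  block≤level n M≤n = ≮⇒≥ λ lt → <-irrefl refl (begin-strict
    n              <⟨ n<size n ⟩
    size (level n) ≤⟨ size-mono-≤ (<⇒≤ lt) ⟩
    S              ≤⟨ m≤m+n S (5 * S) ⟩
    6 * S          ≤⟨ 6S≤M ⟩
    M              ≤⟨ M≤n ⟩
    n              ∎)

  -- With `B ≤ S` a footprint takes at most `9 * S` cells, and `M ≤ 18 * S`; the constant is 9 times
  -- 18. The side of the triangle is `D * S`.
  misses-bound : ∀ D → D * D * (3 * (S / B + 2)) * (B * M) ≤ 162 * ((D * S) * (D * S))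
  misses-bound D = begin
    D * D * (3 * (S / B + 2)) * (B * M)    ≡⟨ regroup D (3 * (S / B + 2)) B M ⟩
    D * D * ((3 * (S / B + 2) * B) * M)
      ≤⟨ *-monoʳ-≤ (D * D) (*-mono-≤ (≤-trans footprint*B (+-monoʳ-≤ (3 * S) (*-monoʳ-≤ 6 B≤S))) M≤18S) ⟩
    D * D * ((3 * S + 6 * S) * (18 * S))   ≡⟨ collect D S ⟩
    162 * ((D * S) * (D * S))              ∎
    where
    regroup : ∀ D X B M → D * D * X * (B * M) ≡ D * D * (X * B * M)
    regroup = solve-∀
    collect : ∀ D S → D * D * ((3 * S + 6 * S) * (18 * S)) ≡ 162 * ((D * S) * (D * S))
    collect = solve-∀

square-size : 1 ≤ n → ∀ m → m * (size (level n) * size (level n)) ≤ m * 9 * (n * n)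
square-size {n} 1≤n m = begin
  m * (size (level n) * size (level n)) ≤⟨ *-monoʳ-≤ m (*-mono-≤ (size≤3n 1≤n) (size≤3n 1≤n)) ⟩
  m * (3 * n * (3 * n))                 ≡⟨ collect m n ⟩
  m * 9 * (n * n)                       ∎
  where
  open ≤-Reasoning
  collect : ∀ m n → m * (3 * n * (3 * n)) ≡ m * 9 * (n * n)
  collect = solve-∀

-- If M < 18 B, then B ≤ 18 τ by the tall-cache assumption: all caches
-- of this kind are bounded, and even a miss at every access is affordable.
small-cache : ∀ τ M B → .{{NonZero B}} → B * B ≤ τ * M → M ≤ 18 * B →
              B * M ≤ 18 * τ * (18 * (18 * τ))
small-cache τ M B tall M≤18B = *-mono-≤ B≤18τ (≤-trans M≤18B (*-monoʳ-≤ 18 B≤18τ))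
  where
  open ≤-Reasoning
  regroup : ∀ τ B → τ * (18 * B) ≡ 18 * τ * B
  regroup = solve-∀
  B≤18τ : B ≤ 18 * τ
  B≤18τ = *-cancelʳ-≤ B (18 * τ) B (begin
    B * B        ≤⟨ tall ⟩
    τ * M        ≤⟨ *-monoʳ-≤ τ M≤18B ⟩
    τ * (18 * B) ≡⟨ regroup τ B ⟩
    18 * τ * B   ∎)

cache-bound : Costs.CacheBound algorithm
cache-bound τ = factor , λ n M B B≤M tall M≤n → bound n M B B≤M tall M≤n (18 * B ≤? M)
  where
  open ≤-Reasoning
  t = 18 * τ * (18 * (18 * τ))
  -- The constant precedes the choice of `M` and `B`, hence adds up the cases of large and of small
  -- caches. Both contain the square of the rounding factor 3.
  factor = 162 * 9 + 9 * t * 9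

  bound : ∀ n M B → .{{_ : NonZero B}} → B ≤ M → B * B ≤ τ * M → M ≤ n → Dec (18 * B ≤ M) →
          ∃[ q ] (MissesAtMost (NDAlgorithm.task algorithm n) M B q ×
                  q * (B * M) ≤ factor * (n * n))
  bound n M B B≤M tall M≤n (yes 18B≤M) =
    D * D * (3 * (S / B + 2)) ,
    subst (λ l → MissesAtMost (Recursion.tri N l 0) M B (D * D * (3 * (S / B + 2)))) d+block≡level
      (Resources.Cached.blocked-misses N M B d block fits) ,
    (begin
      D * D * (3 * (S / B + 2)) * (B * M)  ≤⟨ misses-bound D ⟩
      162 * ((D * S) * (D * S))
        ≡⟨ cong (λ m → 162 * (m * m)) (trans (sym (size-+ d block)) (cong size d+block≡level)) ⟩
      162 * (N * N)                        ≤⟨ square-size 1≤n 162 ⟩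
      162 * 9 * (n * n)                    ≤⟨ *-monoˡ-≤ (n * n) (m≤m+n (162 * 9) (9 * t * 9)) ⟩
      factor * (n * n)                     ∎)
    where
    open LargeCache M B 18B≤M
    N = size (level n)
    d = level n ∸ block
    D = size d
    1≤n : 1 ≤ n
    1≤n = ≤-trans (>-nonZero⁻¹ B) (≤-trans B≤M M≤n)
    d+block≡level : d + block ≡ level n
    d+block≡level = m∸n+n≡m (block≤level n M≤n)
  bound n M B B≤M tall M≤n (no ¬18B≤M) =
    N * N * 9 ,
    Resources.Cached.trivial-misses N M B (level n)
      (≤-trans (≤-reflexive (sym (n/n≡1 B))) (/-monoˡ-≤ B B≤M)) ,
    (begin
      N * N * 9 * (B * M)    ≤⟨ *-monoʳ-≤ (N * N * 9) (small-cache τ M B tall (<⇒≤ (≰⇒> ¬18B≤M))) ⟩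
      N * N * 9 * t          ≡⟨ regroup N t ⟩
      9 * t * (N * N)        ≤⟨ square-size 1≤n (9 * t) ⟩
      9 * t * 9 * (n * n)    ≤⟨ *-monoˡ-≤ (n * n) (m≤n+m (9 * t * 9) (162 * 9)) ⟩
      factor * (n * n)       ∎)
    where
    N = size (level n)
    1≤n : 1 ≤ n
    1≤n = ≤-trans (>-nonZero⁻¹ B) (≤-trans B≤M M≤n)
    regroup : ∀ N t → N * N * 9 * t ≡ 9 * t * (N * N)
    regroup = solve-∀

-- Correctness of every schedule

advance : (ℕ → ℕ) → ℕ → ℕ → ℕ → ℕ
advance m a b x = if does (x ≟ b) then suc a else m x

advance-same : ∀ m a b → advance m a b b ≡ suc a
advance-same m a b rewrite dec-true (b ≟ b) refl = refl

advance-other : ∀ m a {b x} → x ≢ b → advance m a b x ≡ m x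
advance-other m a {b} {x} neq rewrite dec-false (x ≟ b) neq = refl

module Correctness {c ℓ₁ ℓ₂} (ℝ : RealField c ℓ₁ ℓ₂) where
  open RealField ℝ
  open Execution ℝ
  private module Order = IsDecTotalOrder isDecTotalOrder

  store-same : ∀ (μ : Memory) d r → (μ [ d ≔ r ]) d ≡ r
  store-same μ d r rewrite dec-true (d ≟ d) refl = refl

  store-other : ∀ (μ : Memory) {d x} r → x ≢ d → (μ [ d ≔ r ]) x ≡ μ x
  store-other μ {d} {x} r neq rewrite dec-false (x ≟ d) neq = refl

  minimum-cong : ∀ {m f g x y} → (∀ i → i < m → f i ≡ g i) → x ≡ y →
                 IsMinimumBelow m f x → IsMinimumBelow m g y
  minimum-cong {x = x} eq refl (least , i , i<m , attained) =
    (λ i i<m → subst (x ≤ᴿ_) (eq i i<m) (least i i<m)) ,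
    i , i<m , subst (x ≈_) (eq i i<m) attained

  minimum-first : ∀ f → IsMinimumBelow 1 f (f 0)
  minimum-first f = (λ { zero _ → Order.refl ; (suc _) (s≤s ()) }) , 0 , s≤s z≤n , Order.Eq.refl

  -- The conditional is the one computed by `select`, with ties going to the new candidate.
  minimum-step : ∀ {m f x} → IsMinimumBelow m f x →
                 IsMinimumBelow (suc m) f (if does (f m ≤ᴿ? x) then f m else x)
  minimum-step {m} {f} {x} (least , i , i<m , attained) with f m ≤ᴿ? x
  ... | yes fm≤x = below , m , ≤-refl , Order.Eq.refl
    where
    below : ∀ i → i < suc m → f m ≤ᴿ f i
    below i (s≤s i≤m) with m≤n⇒m<n∨m≡n i≤m
    ... | inj₁ i<m  = Order.trans fm≤x (least i i<m)
    ... | inj₂ refl = Order.refl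
  ... | no fm≰x = below , i , m≤n⇒m≤1+n i<m , attained
    where
    below : ∀ i → i < suc m → x ≤ᴿ f i
    below i (s≤s i≤m) with m≤n⇒m<n∨m≡n i≤m
    ... | inj₁ i<m = least i i<m
    ... | inj₂ refl with Order.total x (f m)
    ...   | inj₁ x≤fm = x≤fm
    ...   | inj₂ fm≤x = contradiction fm≤x fm≰x

  module Strands (N : ℕ) (w : Weight) where
    open Recursion N
    open Analysis N

    run : Memory → ℕ → ℕ → Memory
    run μ a b = foldl (step w) μ (strand a b)

    weighted summed : Memory → ℕ → ℕ → Memory
    weighted μ a b = step w μ (weight (scratch b) a b)
    summed μ a b = step w (weighted μ a b) (add (scratch b) a (scratch b))

    <N⇒≢scratch : ∀ {x} b → x < N → x ≢ scratch b
    <N⇒≢scratch b x<N refl = contradiction (≤-<-trans (m≤m+n N b) x<N) (<-irrefl refl)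

    run-frame : ∀ μ a b {x} → x < N → x ≢ b → run μ a b x ≡ μ x
    run-frame μ a b {x} x<N x≢b = strand-elim (λ c → foldl (step w) μ c x ≡ μ x) a b
      (λ _ → unscratched μ)
      (λ _ → trans (store-other (summed μ a b) _ x≢b)
        (trans (unscratched (weighted μ a b)) (unscratched μ)))
      where
      unscratched : ∀ μ {r} → (μ [ scratch b ≔ r ]) x ≡ μ x
      unscratched μ = store-other μ _ (<N⇒≢scratch b x<N)

    run-diagonal : ∀ μ b → b < N → run μ b b b ≡ μ b
    run-diagonal μ b b<N = strand-elim (λ c → foldl (step w) μ c b ≡ μ b) b b
      (λ _ → store-other μ _ (<N⇒≢scratch b b<N)) (contradiction refl)

    candidate : ∀ μ {a b} → a < b → b < N → summed μ a b (scratch b) ≡ μ a +ᴿ w a b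
    candidate μ {a} {b} a<b b<N = trans (store-same (weighted μ a b) (scratch b) _)
      (cong₂ _+ᴿ_ (store-other μ _ (<N⇒≢scratch b (<-trans a<b b<N))) (store-same μ (scratch b) _))

    current : ∀ μ {a b} → b < N → summed μ a b b ≡ μ b
    current μ {a} {b} b<N = trans (store-other (weighted μ a b) _ (<N⇒≢scratch b b<N))
      (store-other μ _ (<N⇒≢scratch b b<N))

    run-relax : ∀ μ {a b} → a < b → run μ a b b ≡
      (let ν = summed μ a b in if does (ν (scratch b) ≤ᴿ? ν b) then ν (scratch b) else ν (keep a b))
    run-relax μ {a} {b} a<b = strand-elim (λ c → foldl (step w) μ c b ≡
        (let ν = summed μ a b in
         if does (ν (scratch b) ≤ᴿ? ν b) then ν (scratch b) else ν (keep a b))) a b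
      (λ eq → contradiction eq (<⇒≢ a<b))
      (λ _ → store-same (summed μ a b) b _)

    -- In row 0 both branches of the selection yield the candidate, whatever `D[b]` held before;
    -- from row 1 on, the selection extends the minimum by one candidate.
    run-minimum : ∀ μ a {b} → a < b → b < N →
                  (1 ≤ a → IsMinimumBelow a (λ i → μ i +ᴿ w i b) (μ b)) →
                  IsMinimumBelow (suc a) (λ i → μ i +ᴿ w i b) (run μ a b b)
    run-minimum μ zero {b} a<b b<N _ =
      minimum-cong (λ _ _ → refl) (sym value₀) (minimum-first (λ i → μ i +ᴿ w i b))
      where
      collapse : ∀ x {A : Set c} (u : A) → (if x then u else u) ≡ u
      collapse true  _ = refl
      collapse false _ = refl

      value₀ : run μ 0 b b ≡ μ 0 +ᴿ w 0 b
      value₀ = trans (run-relax μ a<b)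
        (trans (collapse (does (summed μ 0 b (scratch b) ≤ᴿ? summed μ 0 b b)) _) (candidate μ a<b b<N))
    run-minimum μ (suc a) {b} a<b b<N previous =
      minimum-cong (λ _ _ → refl) (sym value₁) (minimum-step (previous (s≤s z≤n)))
      where
      value₁ : run μ (suc a) b b ≡
        (if does ((μ (suc a) +ᴿ w (suc a) b) ≤ᴿ? μ b) then μ (suc a) +ᴿ w (suc a) b else μ b)
      value₁ = trans (run-relax μ a<b)
        (cong₂ (λ u v → if does (u ≤ᴿ? v) then u else v) (candidate μ a<b b<N) (current μ b<N))

    -- m counts the executed vertices of every column: column b has met the
    -- rows below m b, and is final once its diagonal vertex is executed too.
    record Invariant (μ₀ : Memory) (m : ℕ → ℕ) (μ : Memory) : Set (c ⊔ ℓ₁ ⊔ ℓ₂) where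
      field
        input   : μ 0 ≡ μ₀ 0
        final   : ∀ {a b} → a < b → a < m b → a < m a
        minimal : ∀ {b} → b < N → 1 ≤ b → 1 ≤ m b →
                  IsMinimumBelow (m b ⊓ b) (λ i → μ i +ᴿ w i b) (μ b)

    -- Cell (a,b) is the next one of its column, and column `a` is final if the cell reads it. The
    -- diagonal vertex brings the count to `suc b` without a new candidate, which is why `minimal`
    -- truncates counts at `b`.
    preserve : ∀ {μ₀ m μ a b} → a ≤ b → b < N → m b ≡ a → (a < b → a < m a) →
               Invariant μ₀ m μ → Invariant μ₀ (advance m a b) (run μ a b)
    preserve {μ₀} {m} {μ} {a} {b} a≤b b<N mb≡a ready inv = record
      { input   = input′ (b ≟ 0)
      ; final   = final′
      ; minimal = minimal′
      }
      where
      open Invariant inv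

      frame : ∀ {x} → x < N → x ≢ b → run μ a b x ≡ μ x
      frame = run-frame μ a b

      input′ : Dec (b ≡ 0) → run μ a b 0 ≡ μ₀ 0
      input′ (yes refl) with refl ← n≤0⇒n≡0 a≤b = trans (run-diagonal μ 0 b<N) input
      input′ (no b≢0)   = trans (frame (≤-<-trans z≤n b<N) (b≢0 ∘ sym)) input

      unfinished : ¬ (b < m b)
      unfinished lt = contradiction (≤-trans lt (≤-reflexive mb≡a)) (≤⇒≯ a≤b)

      final′ : ∀ {a′ b′} → a′ < b′ → a′ < advance m a b b′ → a′ < advance m a b a′
      final′ {a′} {b′} lt lt′ with b′ ≟ b
      ... | yes refl = subst (a′ <_) (sym (advance-other m a (<⇒≢ lt)))
        (earlier (m≤n⇒m<n∨m≡n (≤-pred (subst (a′ <_) (advance-same m a b) lt′))))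
        where
        earlier : a′ < a ⊎ a′ ≡ a → a′ < m a′
        earlier (inj₁ a′<a) = final lt (subst (a′ <_) (sym mb≡a) a′<a)
        earlier (inj₂ refl) = ready lt
      ... | no b′≢b with lt″ ← final lt (subst (a′ <_) (advance-other m a b′≢b) lt′) =
        subst (a′ <_) (sym (advance-other m a λ { refl → unfinished lt″ })) lt″

      minimal′ : ∀ {b′} → b′ < N → 1 ≤ b′ → 1 ≤ advance m a b b′ →
                 IsMinimumBelow (advance m a b b′ ⊓ b′) (λ i → run μ a b i +ᴿ w i b′) (run μ a b b′)
      minimal′ {b′} b′<N 1≤b′ 1≤m with b′ ≟ b
      ... | no b′≢b rewrite advance-other m a b′≢b =
        minimum-cong unchanged (sym (frame b′<N b′≢b)) (minimal b′<N 1≤b′ 1≤m)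
        where
        -- Changing `D[b]` disturbs no other column: one that had already met row `b` would require
        -- column `b` to be final.
        unchanged : ∀ i → i < m b′ ⊓ b′ → μ i +ᴿ w i b′ ≡ run μ a b i +ᴿ w i b′
        unchanged i lt = cong (_+ᴿ w i b′) (sym (frame (<-trans i<b′ b′<N)
          λ { refl → unfinished (final i<b′ (≤-trans lt (m⊓n≤m _ _))) }))
          where
          i<b′ : i < b′
          i<b′ = ≤-trans lt (m⊓n≤n _ _)
      ... | yes refl rewrite advance-same m a b with m≤n⇒m<n∨m≡n a≤b
      ...   | inj₁ a<b rewrite m≤n⇒m⊓n≡m a<b =
        minimum-cong
          (λ i lt → cong (_+ᴿ w i b) (sym (frame (<-trans (i<b lt) b<N) (<⇒≢ (i<b lt))))) refl
          (run-minimum μ a a<b b<N λ 1≤a →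
            subst (λ l → IsMinimumBelow l (λ i → μ i +ᴿ w i b) (μ b))
              (trans (cong (_⊓ b) mb≡a) (m≤n⇒m⊓n≡m a≤b))
              (minimal b<N 1≤b′ (≤-trans 1≤a (≤-reflexive (sym mb≡a)))))
        where
        i<b : ∀ {i} → i < suc a → i < b
        i<b lt = ≤-trans lt a<b
      -- On the diagonal, the truncated count is `b` both before and after.
      ...   | inj₂ refl rewrite m≥n⇒m⊓n≡n (n≤1+n b) =
        minimum-cong (λ i lt → cong (_+ᴿ w i b) (sym (frame (<-trans lt b<N) (<⇒≢ lt))))
          (sym (run-diagonal μ b b<N))
          (subst (λ l → IsMinimumBelow l (λ i → μ i +ᴿ w i b) (μ b))
            (trans (cong (_⊓ b) mb≡a) (⊓-idem b))
            (minimal b<N 1≤b′ (≤-trans 1≤b′ (≤-reflexive (sym mb≡a)))))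

  module Schedules (k : ℕ) (w : Weight) where
    open Recursion (size k)
    open Strands (size k) w

    Ordered : List Vertex → Set
    Ordered = AllPairs (λ u v → ¬ (tri k 0 ⊢ v ⟶ u))

    -- The first implication bounds the count of a scheduled vertex; the second one places every
    -- cell not yet counted in the rest of the schedule.
    Remaining : List Vertex → (ℕ → ℕ) → Set
    Remaining σ m = ∀ {p a b} → TriLeaf k 0 p a b →
                    ((p , strand a b) ∈ σ → m b ≤ a) × (m b ≤ a → (p , strand a b) ∈ σ)

    -- The leading `weight` carries the coordinates, so equal strands have equal coordinates.
    distinct : ∀ {p q : Path} {a b a′ b′} → a′ ≢ a ⊎ b′ ≢ b → (p , strand a′ b′) ≢ (q , strand a b)
    distinct neq eq with refl ← ∷-injectiveˡ (cong proj₂ eq) with neq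
    ... | inj₁ a≢a = a≢a refl
    ... | inj₂ b≢b = b≢b refl

    later : ∀ {u v : Vertex} {σ} → v ≢ u → v ∈ u ∷ σ → v ∈ σ
    later neq (here eq) = contradiction eq neq
    later neq (there m) = m

    -- Being first determines the state of a vertex: an unexecuted cell above it in its column, or
    -- an unexecuted diagonal cell of its row to its left, would have an edge to it and still come
    -- later.
    execute : ∀ σ {μ₀} m μ → All (_∈ vertices (tri k 0)) σ → Unique σ → Ordered σ →
              Remaining σ m → Invariant μ₀ m μ →
              ∃[ m′ ] (Remaining [] m′ × Invariant μ₀ m′ (runSchedule w μ σ))
    execute [] m μ _ _ _ remaining inv = m , remaining , inv
    execute (v ∷ σ) m μ (v∈ ∷ σ∈) (fresh ∷ unique) (first ∷ ordered) remaining inv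
      with a , b , l , refl ← tri-vertex k v∈ =
      execute σ (advance m a b) (run μ a b) σ∈ unique ordered remaining′
        (preserve (tri-upper l) b<N mb≡a ready inv)
      where
      b<N : b < size k
      b<N = InBlock.upper (tri-column l)

      mb≤a : m b ≤ a
      mb≤a = proj₁ (remaining l) (here refl)

      -- A vertex with an edge to the first one of a schedule cannot come later.
      blocked : ∀ {p a′ b′} → TriLeaf k 0 p a′ b′ → m b′ ≤ a′ → a′ ≢ a ⊎ b′ ≢ b →
                ¬ (tri k 0 ⊢ (p , strand a′ b′) ⟶ (_ , strand a b))
      blocked l′ le neq e = All.lookup first (later (distinct neq) (proj₂ (remaining l′) le)) e

      mb≡a : m b ≡ a
      mb≡a with m≤n⇒m<n∨m≡n mb≤a
      ... | inj₂ eq = eq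
      ... | inj₁ lt with _ , l′ ← tri-exists k (≤-trans mb≤a (tri-upper l))
                                  (z≤n , ≤-<-trans mb≤a (InBlock.upper (tri-row l))) (tri-column l) =
        contradiction (tri-column-edge l′ l lt) (blocked l′ ≤-refl (inj₁ (<⇒≢ lt)))

      ready : a < b → a < m a
      ready a<b = ≰⇒> λ ma≤a → let _ , l′ = tri-exists k ≤-refl (tri-row l) (tri-row l) in
        blocked l′ ma≤a (inj₂ (<⇒≢ a<b)) (tri-diagonal-edge l′ l a<b)

      remaining′ : Remaining σ (advance m a b)
      remaining′ {p′} {a′} {b′} l′ with b′ ≟ b
      ... | no neq rewrite advance-other m a neq =
        (λ u∈ → proj₁ (remaining l′) (there u∈)) ,
        (λ le → later (distinct (inj₂ neq)) (proj₂ (remaining l′) le))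
      ... | yes refl rewrite advance-same m a b =
        (λ u∈ → ≤∧≢⇒< (subst (_≤ a′) mb≡a (proj₁ (remaining l′) (there u∈))) λ { refl →
          All.lookup fresh u∈ (cong (_, strand a b) (tri-injective l l′)) }) ,
        (λ lt → later (distinct (inj₁ (<⇒≢ lt ∘ sym)))
          (proj₂ (remaining l′) (≤-trans mb≤a (<⇒≤ lt))))

    tri-correct : ∀ {n} → n < size k → ∀ μ σ → IsSchedule (tri k 0) σ →
                  Solution w n μ (runSchedule w μ σ)
    tri-correct {n} n<N μ σ record { complete = complete ; ordered = ordered }
      with m , remaining , inv ←
      execute σ (λ _ → 0) μ
        (All.tabulate (∈-resp-↭ complete))
        (Permutationₛ.Unique-resp-↭ (setoid Vertex) (↭⇒↭ₛ (↭-sym complete))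
          (vertices-unique (tri k 0)))
        ordered
        (λ l → (λ _ → z≤n) ,
          λ _ → ∈-resp-↭ (↭-sym complete) (leaf⇒vertex (tri k 0) _ (tri-leaf⁺ l)))
        -- All counts are 0, so only the input cell is constrained.
        (record { input = refl ; final = λ _ () ; minimal = λ _ _ () }) =
      Order.Eq.reflexive (Invariant.input inv) ,
      λ j 1≤j j≤n → solved m remaining inv 1≤j (≤-<-trans j≤n n<N)
      where
      solved : ∀ m {D} → Remaining [] m → Invariant μ m D → ∀ {j} → 1 ≤ j → j < size k →
               IsMinimumBelow j (λ i → D i +ᴿ w i j) (D j)
      solved m {D} remaining inv {j} 1≤j j<N
        with _ , l ← tri-exists k ≤-refl (z≤n , j<N) (z≤n , j<N) =
        subst (λ i → IsMinimumBelow i (λ i → D i +ᴿ w i j) (D j)) (m≥n⇒m⊓n≡n (<⇒≤ j<m))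
          (Invariant.minimal inv j<N 1≤j (≤-trans 1≤j (<⇒≤ j<m)))
        where
        j<m : j < m j
        -- Otherwise the diagonal vertex of column `j` would remain in the empty schedule.
        j<m = ≰⇒> λ le → case proj₂ (remaining l) le of λ ()

  algorithm-solves : Solves algorithm
  algorithm-solves n =
    Analysis.tri-race-free (size (level n)) (level n) refl ,
    λ w μ σ schedule → Schedules.tri-correct (level n) w (n<size n) μ σ schedule

-- The serial lower bound

unique-⊆⇒length-≤ : ∀ {ℓ} {A : Set ℓ} {xs ys : List A} → Unique xs → xs ⊆ ys → length xs ≤ length ys
unique-⊆⇒length-≤ []                 _   = z≤n
unique-⊆⇒length-≤ {xs = x ∷ xs} (fresh ∷ unique) sub
  with as , bs , refl ← ∈-∃++ (sub (here refl)) =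
  ≤-trans (s≤s (unique-⊆⇒length-≤ unique remaining)) (≤-reflexive (sym removed))
  where
  remaining : xs ⊆ as ++ bs
  remaining m with ∈-++⁻ as (sub (there m))
  ... | inj₁ m′           = ∈-++⁺ˡ m′
  ... | inj₂ (here eq)    = contradiction (sym eq) (All.lookup fresh m)
  ... | inj₂ (there m′)   = ∈-++⁺ʳ as m′

  removed : length (as ++ x ∷ bs) ≡ suc (length (as ++ bs))
  removed = trans (length-++ as)
    (trans (+-suc (length as) (length bs)) (cong suc (sym (length-++ as))))

pairs : ℕ → List (ℕ × ℕ)
pairs zero    = []
pairs (suc n) = map (_, suc n) (upTo (suc n)) ++ pairs n

pairs⁻ : ∀ n {i j} → (i , j) ∈ pairs n → i < j × j ≤ n
pairs⁻ (suc n) m with ∈-++⁻ (map (_, suc n) (upTo (suc n))) m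
... | inj₁ m′ with _ , i∈ , refl ← ∈-map⁻ (_, suc n) m′ = ∈-upTo⁻ i∈ , ≤-refl
... | inj₂ m′ with i<j , j≤n ← pairs⁻ n m′ = i<j , m≤n⇒m≤1+n j≤n

pairs-unique : ∀ n → Unique (pairs n)
pairs-unique zero    = []
pairs-unique (suc n) =
  Unique.++⁺ (Unique.map⁺ (cong proj₁) (Unique.upTo⁺ (suc n))) (pairs-unique n) disjoint
  where
  disjoint : ∀ {v} → ¬ (v ∈ map (_, suc n) (upTo (suc n)) × v ∈ pairs n)
  disjoint (m , m′) with _ , _ , refl ← ∈-map⁻ (_, suc n) m = <-irrefl refl (proj₂ (pairs⁻ n m′))

pairs-length : ∀ n → 2 * length (pairs n) ≡ n * suc n
pairs-length zero    = refl
pairs-length (suc n) = begin-equality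
  2 * length (map (_, suc n) (upTo (suc n)) ++ pairs n)
    ≡⟨ cong (2 *_) (length-++ (map (_, suc n) (upTo (suc n)))) ⟩
  2 * (length (map (_, suc n) (upTo (suc n))) + length (pairs n))
    ≡⟨ cong (λ l → 2 * (l + length (pairs n)))
            (trans (length-map (_, suc n) (upTo (suc n))) (length-upTo (suc n))) ⟩
  2 * (suc n + length (pairs n))     ≡⟨ *-distribˡ-+ 2 (suc n) (length (pairs n)) ⟩
  2 * suc n + 2 * length (pairs n)   ≡⟨ cong (2 * suc n +_) (pairs-length n) ⟩
  2 * suc n + n * suc n              ≡⟨ *-distribʳ-+ (suc n) 2 n ⟨
  (2 + n) * suc n                    ≡⟨ *-comm (2 + n) (suc n) ⟩
  suc n * suc (suc n)                ∎
  where open ≤-Reasoning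

module SerialBound {c ℓ₁ ℓ₂} (ℝ : RealField c ℓ₁ ℓ₂) where
  open RealField ℝ renaming (+-monoˡ-≤ to +ᴿ-monoˡ-≤)
  open Execution ℝ
  private
    module Order = IsDecTotalOrder isDecTotalOrder
    module Ring = CommutativeRing commutativeRing

  _≟²_ : DecidableEquality (ℕ × ℕ)
  _≟²_ = ≡-dec _≟_ _≟_

  open DecMembership _≟²_ using (_∈?_)

  queries : Instr → List (ℕ × ℕ)
  queries (weight _ i j) = (i , j) ∷ []
  queries _              = []

  queried : Weight → Memory → Serial → List (ℕ × ℕ)
  queried w μ halt             = []
  queried w μ (ι ▸ p)          = queries ι ++ queried w (step w μ ι) p
  queried w μ (branch x y p q) = if does (μ x ≤ᴿ? μ y) then queried w μ p else queried w μ q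

  length-queries : ∀ ι → length (queries ι) ≤ 1
  length-queries (move _ _)         = z≤n
  length-queries (add _ _ _)        = z≤n
  length-queries (mul _ _ _)        = z≤n
  length-queries (select _ _ _ _ _) = z≤n
  length-queries (weight _ _ _)     = ≤-refl

  queried≤work : ∀ w μ p → length (queried w μ p) ≤ serialWork w μ p
  queried≤work w μ halt    = z≤n
  queried≤work w μ (ι ▸ p) = ≤-trans (≤-reflexive (length-++ (queries ι)))
    (+-mono-≤ (length-queries ι) (queried≤work w (step w μ ι) p))
  queried≤work w μ (branch x y p q) with μ x ≤ᴿ? μ y
  ... | yes _ = m≤n⇒m≤1+n (queried≤work w μ p)
  ... | no _  = m≤n⇒m≤1+n (queried≤work w μ q)

  -- Propositional equality makes the final memories equal outright, and both runs take the same
  -- branches.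
  Agree : Weight → Weight → List (ℕ × ℕ) → Set c
  Agree w w′ ps = ∀ {i j} → (i , j) ∈ ps → w i j ≡ w′ i j

  step-agree : ∀ {w w′} μ ι → Agree w w′ (queries ι) → step w μ ι ≡ step w′ μ ι
  step-agree μ (move _ _)         _     = refl
  step-agree μ (add _ _ _)        _     = refl
  step-agree μ (mul _ _ _)        _     = refl
  step-agree μ (select _ _ _ _ _) _     = refl
  step-agree μ (weight d i j)     agree = cong (μ [ d ≔_]) (agree (here refl))

  run-agree : ∀ {w w′} μ p → Agree w w′ (queried w μ p) → runSerial w μ p ≡ runSerial w′ μ p
  run-agree μ halt agree = refl
  run-agree {w} {w′} μ (ι ▸ p) agree =
    trans (run-agree (step w μ ι) p (agree ∘ ∈-++⁺ʳ (queries ι)))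
          (cong (λ ν → runSerial w′ ν p) (step-agree {w} {w′} μ ι (agree ∘ ∈-++⁺ˡ)))
  run-agree μ (branch x y p q) agree with μ x ≤ᴿ? μ y
  ... | yes _ = run-agree μ p agree
  ... | no _  = run-agree μ q agree

  -- Totality offers 1 itself or -1; were the chosen one nonnegative, antisymmetry would identify 0
  -- and 1.
  negative : ∃[ e ] ¬ (0# ≤ᴿ e)
  negative with Order.total 0# 1#
  ... | inj₂ 1≤0 = 1# , λ 0≤1 → 0≉1 (Order.antisym 0≤1 1≤0)
  ... | inj₁ 0≤1 = Ring.- 1# , λ 0≤-1 → 0≉1 (Order.antisym 0≤1
    (Order.≤-respˡ-≈ (Ring.+-identityˡ 1#)
      (Order.≤-respʳ-≈ (Ring.-‿inverseˡ 1#) (+ᴿ-monoˡ-≤ 1# 0≤-1))))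

  w₀ : Weight
  w₀ _ _ = 0#

  μ₀ : Memory
  μ₀ _ = 0#

  spike : ℕ × ℕ → Weight
  spike ij a b = if does ((a , b) ≟² ij) then proj₁ negative else 0#

  spike-at : ∀ i j → spike (i , j) i j ≡ proj₁ negative
  spike-at i j rewrite dec-true ((i , j) ≟² (i , j)) refl = refl

  spike-off : ∀ a b {ij} → (a , b) ≢ ij → spike ij a b ≡ 0#
  spike-off a b {ij} neq rewrite dec-false ((a , b) ≟² ij) neq = refl

  -- Strong induction: with zero weights, the minimum is attained at an earlier value, which
  -- vanishes.
  zero-solution : ∀ {n D} → Solution w₀ n μ₀ D → ∀ j → j ≤ n → D j ≈ 0#
  zero-solution {n} {D} (input , solved) = <-rec _ vanishes
    where
    vanishes : ∀ j → (∀ {i} → i < j → i ≤ n → D i ≈ 0#) → j ≤ n → D j ≈ 0#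
    vanishes zero    _  _   = input
    vanishes (suc j) ih j≤n with _ , i , i<j , attained ← solved (suc j) (s≤s z≤n) j≤n =
      Ring.trans attained (Ring.trans (Ring.+-identityʳ (D i)) (ih i<j (≤-trans (<⇒≤ i<j) j≤n)))

  -- On zero weights all D[j] vanish; lowering a weight that the program
  -- did not look at would go unnoticed.
  all-queried : ∀ {n} p → SerialSolves n p → ∀ {i j} → i < j → j ≤ n → (i , j) ∈ queried w₀ μ₀ p
  all-queried {n} p solves {i} {j} i<j j≤n with (i , j) ∈? queried w₀ μ₀ p
  ... | yes m = m
  ... | no ∉ = contradiction 0≤e (proj₂ negative)
    where
    D : Memory
    D = runSerial w₀ μ₀ p

    unnoticed : D ≡ runSerial (spike (i , j)) μ₀ p
    unnoticed = run-agree μ₀ p λ {a} {b} m → sym (spike-off a b λ { refl → ∉ m })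

    vanishes : ∀ l → l ≤ n → D l ≈ 0#
    vanishes = zero-solution (solves w₀ μ₀)

    spiked : Solution (spike (i , j)) n μ₀ D
    spiked = subst (Solution (spike (i , j)) n μ₀) (sym unnoticed) (solves (spike (i , j)) μ₀)

    below : D j ≤ᴿ (D i +ᴿ proj₁ negative)
    below = subst (λ e → D j ≤ᴿ (D i +ᴿ e)) (spike-at i j)
      (proj₁ (proj₂ spiked j (≤-trans (s≤s z≤n) i<j) j≤n) i i<j)

    0≤e : 0# ≤ᴿ proj₁ negative
    0≤e = Order.≤-respˡ-≈ (vanishes j j≤n) (Order.≤-respʳ-≈
      (Ring.trans (Ring.+-congʳ (vanishes i (≤-trans (<⇒≤ i<j) j≤n))) (Ring.+-identityˡ _)) below)

  -- There are `n * suc n` / 2 distinct pairs to query, and an instruction queries at most one.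
  serial-work : ∀ {n} p → SerialSolves n p → n * n ≤ 2 * serialWork w₀ μ₀ p
  serial-work {n} p solves = begin
    n * n                            ≤⟨ *-monoʳ-≤ n (n≤1+n n) ⟩
    n * suc n                        ≡⟨ pairs-length n ⟨
    2 * length (pairs n)             ≤⟨ *-monoʳ-≤ 2 (unique-⊆⇒length-≤ (pairs-unique n)
                                          λ m → let i<j , j≤n = pairs⁻ n m in
                                                all-queried p solves i<j j≤n) ⟩
    2 * length (queried w₀ μ₀ p)     ≤⟨ *-monoʳ-≤ 2 (queried≤work w₀ μ₀ p) ⟩
    2 * serialWork w₀ μ₀ p           ∎
    where open ≤-Reasoning

  work-optimal : ∀ A → Costs.QuadraticWork A → WorkOptimal A
  work-optimal A (k , quadratic) = k * 2 , λ n 1≤n p solves → w₀ , μ₀ , (begin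
    work (NDAlgorithm.task A n)      ≤⟨ quadratic n 1≤n ⟩
    k * (n * n)                      ≤⟨ *-monoʳ-≤ k (serial-work p solves) ⟩
    k * (2 * serialWork w₀ μ₀ p)     ≡⟨ *-assoc k 2 _ ⟨
    k * 2 * serialWork w₀ μ₀ p       ∎)
    where open ≤-Reasoning

theorem5 : ∀ {c ℓ₁ ℓ₂ : Level} (ℝ : RealField c ℓ₁ ℓ₂) →
    let open Execution ℝ in
    ∃[ A ] (let open Costs A in
    Solves A × LinearTime × QuadraticWork × WorkOptimal A × LinearSpace × CacheBound)
theorem5 ℝ = algorithm , Correctness.algorithm-solves ℝ , linear-time , quadratic-work ,
  SerialBound.work-optimal ℝ algorithm quadratic-work , linear-space , cache-bound
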